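{- Let $G$ be an $n$-vertex graph of girth at least $5$ embedded on a surface of Euler genus $g$. Suppose $G$ is DP-$k$-colorable, where $k$ is a power of a prime and $k>2$. If $n\ge 5g$, then $$P_{DP}(G,k)\ge k^{\left(\frac{(n-5g)(k-2)}{3}-(k-3)\right)/(k-1)}.$$
   Context: For a finite set $A$ with $|A|=k$ and symmetric group $S_A$, an $S_A$-labeling of $G$ is $(D,\sigma)$ with $D$ an orientation of $G$ and $\sigma:E(D)\to S_A$; a proper coloring of it is $\kappa:V(G)\to A$ with $\sigma(u,v)(\kappa(u))\ne\kappa(v)$ for every arc $(u,v)$. $G$ is DP-$k$-colorable if every such $S_A$-labeling has a proper coloring. $P_{DP}(G,k)$ is the minimum over all $S_A$-labelings of $G$ of the number of proper colorings. -}

module Defs where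

open import Data.Nat using (ℕ; zero; suc; _+_; _*_; _∸_; _^_; _≤_; _<_; _≤ᵇ_)
open import Data.Bool using (Bool; true; false; _∧_; _∨_; not; if_then_else_)
open import Data.Fin using (Fin; toℕ; _≟_)
open import Data.Fin.Permutation using (Permutation′; _⟨$⟩ʳ_)
open import Data.Vec.Functional using (_∷_)
open import Data.Product using (Σ; _×_; _,_; ∃)
open import Data.Empty using (⊥)
open import Relation.Nullary using (¬_)
open import Relation.Nullary.Decidable using (⌊_⌋)
open import Relation.Binary.PropositionalEquality using (_≡_; _≢_)
open import Data.Nat.Primality using (Prime)

count : {m : ℕ} → (Fin m → Bool) → ℕ
count {zero}  P = 0
count {suc m} P = (if P Data.Fin.zero then 1 else 0) + count (λ i → P (Data.Fin.suc i))

allFin : {m : ℕ} → (Fin m → Bool) → Bool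
allFin {zero}  P = true
allFin {suc m} P = P Data.Fin.zero ∧ allFin (λ i → P (Data.Fin.suc i))

anyFin : {m : ℕ} → (Fin m → Bool) → Bool
anyFin {zero}  P = false
anyFin {suc m} P = P Data.Fin.zero ∨ anyFin (λ i → P (Data.Fin.suc i))

allBelow : ℕ → (ℕ → Bool) → Bool
allBelow zero    P = true
allBelow (suc N) P = allBelow N P ∧ P N

sumFin : {m : ℕ} → (Fin m → ℕ) → ℕ
sumFin {zero}  F = 0
sumFin {suc m} F = F Data.Fin.zero + sumFin (λ i → F (Data.Fin.suc i))

countFun : (n k : ℕ) → ((Fin n → Fin k) → Bool) → ℕ
countFun zero    k P = if P (λ ()) then 1 else 0
countFun (suc n) k P = sumFin (λ a → countFun n k (λ f → P (a ∷ f)))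

iter : {A : Set} → (A → A) → ℕ → A → A
iter f zero    x = x
iter f (suc m) x = f (iter f m x)

record Graph (n : ℕ) : Set where
  field
    adj    : Fin n → Fin n → Bool
    sym    : ∀ u v → adj u v ≡ adj v u
    irrefl : ∀ v → adj v v ≡ false
open Graph public

Adj : {n : ℕ} → Graph n → Fin n → Fin n → Set
Adj G u v = adj G u v ≡ true

-- girth at least 5: no cycle of length 3 or 4 (loops and multi-edges are
-- already excluded since G is simple)
Girth≥5 : {n : ℕ} → Graph n → Set
Girth≥5 {n} G =
  (∀ (a b c : Fin n) → Adj G a b → Adj G b c → Adj G c a → ⊥) ×
  (∀ (a b c d : Fin n) → a ≢ c → b ≢ d →
     Adj G a b → Adj G b c → Adj G c d → Adj G d a → ⊥)

numEdges : {n : ℕ} → Graph n → ℕ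
numEdges G = sumFin (λ u → count (λ v → adj G u v ∧ (suc (toℕ u) ≤ᵇ toℕ v)))

numIsolated : {n : ℕ} → Graph n → ℕ
numIsolated G = count (λ v → not (anyFin (λ w → adj G v w)))

reach : {n : ℕ} → Graph n → ℕ → Fin n → Fin n → Bool
reach G zero    u v = ⌊ u ≟ v ⌋
reach G (suc m) u v = reach G m u v ∨ anyFin (λ w → reach G m u w ∧ adj G w v)

-- number of connected components (= number of vertices that are the
-- least vertex of their component)
numComponents : {n : ℕ} → Graph n → ℕ
numComponents {n} G =
  count (λ v → allFin (λ w → not (reach G n w v) ∨ (toℕ v ≤ᵇ toℕ w)))

-- Combinatorial embeddings: embedding schemes (Mohar–Thomassen,
-- "Graphs on Surfaces", §3.3): a rotation system (a cyclic permutation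
-- ρ v of the neighbours of each vertex v, with inverse ρ⁻ v) together
-- with a signature λ : E(G) → {+1,-1} (true = +1).

record Scheme {n : ℕ} (G : Graph n) : Set where
  field
    ρ  : Fin n → Fin n → Fin n
    ρ⁻ : Fin n → Fin n → Fin n
    λs : Fin n → Fin n → Bool
    λs-sym   : ∀ u v → λs u v ≡ λs v u
    ρ-nbr    : ∀ v u → Adj G v u → Adj G v (ρ v u)
    ρ⁻-nbr   : ∀ v u → Adj G v u → Adj G v (ρ⁻ v u)
    ρ⁻ρ      : ∀ v u → Adj G v u → ρ⁻ v (ρ v u) ≡ u
    ρρ⁻      : ∀ v u → Adj G v u → ρ v (ρ⁻ v u) ≡ u
    ρ-cyclic : ∀ v u w → Adj G v u → Adj G v w → ∃ λ m → iter (ρ v) m u ≡ w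
open Scheme public

-- Face tracing: a state (u , v , s) is the dart u→v traversed with the
-- current local orientation s.  Each face boundary walk of the
-- 2-cell embedding determined by the scheme corresponds to exactly two
-- orbits of `step` on the states with u ~ v (its two traversal directions).
State : ℕ → Set
State n = Fin n × Fin n × Bool

step : {n : ℕ} {G : Graph n} → Scheme G → State n → State n
step S (u , v , s) =
  let s' = if λs S u v then s else not s in
  (v , (if s' then ρ S v u else ρ⁻ S v u) , s')

key : {n : ℕ} → State n → ℕ
key {n} (u , v , s) = (toℕ u * n + toℕ v) * 2 + (if s then 1 else 0)

-- number of orbits of `step` on the dart states (each orbit counted once
-- via its key-minimal element; orbits have size ≤ 2n², so 2n²+1 iterations
-- suffice)
numOrbits : {n : ℕ} {G : Graph n} → Scheme G → ℕ
numOrbits {n} {G} S =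
  sumFin λ u → sumFin λ v → count λ (s : Fin 2) →
    let x = (u , v , ⌊ s ≟ Data.Fin.zero ⌋) in
    adj G u v ∧ allBelow (suc (2 * n * n))
                   (λ m → key x ≤ᵇ key (iter (step S) m x))

-- Number of faces of the embedding given by the scheme: each face of a
-- component with edges is counted by two orbits; each isolated vertex is a
-- component (sphere) with one face.
-- Euler's formula per component: n_i - e_i + f_i = 2 - g_i, so the total
-- Euler genus of the embedding is  2c - n + e - f.  We express
--   2c - n + e - (orbits/2 + iso) ≤ g
-- multiplied by 2 and without truncated subtraction.
EulerGenus≤ : {n : ℕ} {G : Graph n} → Scheme G → ℕ → Set
EulerGenus≤ {n} {G} S g =
  2 * (2 * numComponents G + numEdges G)
    ≤ 2 * g + 2 * n + numOrbits S + 2 * numIsolated G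

EmbedsInEulerGenus : {n : ℕ} → Graph n → ℕ → Set
EmbedsInEulerGenus G g = Σ (Scheme G) λ S → EulerGenus≤ S g

-- DP-colouring with colour set A = Fin k, S_A = Permutation′ k.
-- An S_A-labeling (D , σ): for each edge {u,v} with u < v, `orient u v`
-- says whether the arc is (u,v) (true) or (v,u) (false); σ u v is the
-- permutation on that arc.

record Labeling {n : ℕ} (G : Graph n) (k : ℕ) : Set where
  field
    orient : Fin n → Fin n → Bool
    σ      : Fin n → Fin n → Permutation′ k
open Labeling public

arcOK : {n k : ℕ} {G : Graph n} → Labeling G k → (Fin n → Fin k) →
        Fin n → Fin n → Bool
arcOK L κ u v =
  if orient L u v
  then not ⌊ (σ L u v ⟨$⟩ʳ κ u) ≟ κ v ⌋
  else not ⌊ (σ L u v ⟨$⟩ʳ κ v) ≟ κ u ⌋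

isProper : {n k : ℕ} {G : Graph n} → Labeling G k → (Fin n → Fin k) → Bool
isProper {G = G} L κ =
  allFin λ u → allFin λ v →
    not (adj G u v ∧ (suc (toℕ u) ≤ᵇ toℕ v)) ∨ arcOK L κ u v

numProper : {n k : ℕ} {G : Graph n} → Labeling G k → ℕ
numProper {n} {k} L = countFun n k (isProper L)

DPColorable : {n : ℕ} → Graph n → ℕ → Set
DPColorable {n} G k =
  (L : Labeling G k) → ∃ λ (κ : Fin n → Fin k) → isProper L κ ≡ true

IsPrimePower : ℕ → Set
IsPrimePower k = ∃ λ p → ∃ λ e → Prime p × k ≡ p ^ e

{-# OPTIONS --safe #-}

-- Let the variable of each vertex range over an additive group A of k = p^e
-- elements: the polynomials of degree less than e over the field with p
-- elements, inside the power series.  An edge with permutation θ contributes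
-- the factor C y - ∑_a θ(a) ∏_{b ≠ a} (x - b), where C is the product of the
-- nonzero elements of A; it vanishes exactly at the conflicts, and its degree
-- is only k - 2 because the elements of A add up to zero.  After renaming the
-- colours along a spanning forest the forest edges carry the identity, so that
-- y - x, of degree 1, serves for them.  The product over the edges has degree
-- d = (n - c) + (k - 2)(m - n + c), for m edges and c components, and its
-- nonzeros are the proper colourings; as there is one, the Alon–Füredi theorem
-- gives at least k^(n - d/(k-1)) of them.
--
-- A face walk has length at least 5, except for at most two traversals in each
-- component, which is then K₂ or P₃.  Euler's formula thus yields
-- 3 m + 5 c ≤ 5 n + 5 g, which bounds d.

module Submission where

open import Algebra.Bundles using (CommutativeRing; CommutativeMonoid)
import Algebra.Construct.Pointwise as Pointwise
import Algebra.Properties.CommutativeMonoid.Sum as MonoidSum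
import Algebra.Properties.CommutativeSemigroup as CommutativeSemigroupProperties
import Algebra.Properties.Monoid.Mult as MonoidMult
import Algebra.Properties.Ring as RingProperties
import Algebra.Properties.Semiring.Exp as Exp
import Algebra.Properties.Semiring.Sum as SemiringSum
import Algebra.Solver.Ring.NaturalCoefficients.Default as SemiringSolver
open import Data.Bool using (Bool; true; false; _∧_; if_then_else_; not; _∨_; T)
import Data.Bool.Properties as Boolₚ
open import Data.Fin as Fin using (Fin; zero; suc; punchIn; punchOut; toℕ; combine; remQuot; opposite; _↑ˡ_; _↑ʳ_)
open import Data.Fin.Permutation as Perm using (Permutation′; _⟨$⟩ʳ_; permutation; _⟨$⟩ˡ_; _∘ₚ_; flip)
import Data.Fin.Properties as Finₚ
open import Data.Integer as ℤ using (ℤ; +_; 0ℤ; 1ℤ)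
import Data.Integer.Properties as ℤₚ
open import Data.Integer.Tactic.RingSolver using (solve-∀)
open import Data.List as List using (List; []; _∷_; length; _++_; cartesianProduct)
open import Data.List.Membership.Propositional using (_∈_; _∉_)
open import Data.List.Membership.Propositional.Properties using (∈-filter⁻; ∈-allFin; ∈-filter⁺; ∈-cartesianProduct⁺; ∈-∃++; ∈-++⁺ˡ; ∈-++⁺ʳ; ∈-++⁻)
import Data.List.Properties as Listₚ
open import Data.List.Relation.Unary.All as All using (All; []; _∷_)
open import Data.List.Relation.Unary.AllPairs using ([]; _∷_)
open import Data.List.Relation.Unary.Any using (here; there)
open import Data.List.Relation.Unary.Unique.Propositional using (Unique)
open import Data.List.Relation.Unary.Unique.Propositional.Properties using (filter⁺; allFin⁺; cartesianProduct⁺)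
open import Data.Nat as ℕ using (ℕ; zero; suc; z≤n; s≤s; NonZero; _≤ᵇ_)
open import Data.Nat.DivMod using (_mod_; _%_; m≡m%n+[m/n]*n; m%n<n)
open import Data.Nat.Divisibility using (_∣_; divides; ∣⇒≤)
open import Data.Nat.Induction using (<-wellFounded)
open import Data.Nat.ListAction using (sum)
open import Data.Nat.Primality using (Prime; prime⇒nonZero; prime⇒nonTrivial; euclidsLemma)
import Data.Nat.Properties as ℕₚ
open import Data.Nat.Tactic.RingSolver using () renaming (solve-∀ to ℕ-solve-∀)
open import Data.Product using (_×_; _,_; ∃; ∃₂; proj₁; proj₂)
open import Data.Sum using (_⊎_; inj₁; inj₂)
open import Data.Vec using (Vec; []; _∷_; lookup; head; tail; tabulate)
import Data.Vec.Functional as Functional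
open import Data.Vec.Properties using (lookup∘tabulate)
open import Defs hiding (sym)
open import Function using (_∘_; id)
open import Induction.WellFounded using (Acc; acc)
open import Level using (0ℓ)
open import Relation.Binary.Definitions using (tri<; tri≈; tri>)
open import Relation.Binary.PropositionalEquality as ≡ using (_≡_; _≢_)
import Relation.Binary.Reasoning.Setoid as SetoidReasoning
open import Relation.Nullary using (¬_; yes; no; contradiction; Dec)
open import Relation.Nullary.Decidable using (⌊_⌋)

-- The straightened forest carries the bound. If all m edges had degree k - 2, then 3 m ≤ 5 n + 5 g
-- would give n only the coefficient 3 (k - 1) - 5 (k - 2) = 7 - 2 k in 3 n (k - 1) - 3 d, which is
-- negative from k = 4 on. A forest edge saves k - 3, and the n - c of them raise the coefficient to
-- k - 2. A field with k elements would call for an irreducible polynomial of degree e. But no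
-- product of colours has to lie in A again: interpolation asks only that A be closed under
-- subtraction, that differences of distinct colours be regular in the surrounding ring, and that
-- the colours add up to zero. Nor is any division needed, since b ↦ a - b permutes A and so makes
-- all the denominators of the interpolation formula equal to C.

module ℕ* = CommutativeSemigroupProperties ℕₚ.*-commutativeSemigroup

-- Polynomial functions on a grid: degree and division by linear factors

module Polynomials (R : CommutativeRing 0ℓ 0ℓ) where
  open CommutativeRing R hiding (zero)
  open SetoidReasoning setoid
  open SemiringSolver commutativeSemiring using (solve; _:=_; _:+_; _:*_)

  -- Regular elements play the role of nonzero ones, so that neither
  -- decidability of ≈ nor the absence of zero divisors is needed.
  Regular : Carrier → Set
  Regular r = ∀ s → r * s ≈ 0# → s ≈ 0#

  regular-cong : ∀ {r s} → r ≈ s → Regular r → Regular s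
  regular-cong r≈s reg t st≈0 = reg t (trans (*-congʳ r≈s) st≈0)

  regular-1 : Regular 1#
  regular-1 s eq = trans (sym (*-identityˡ s)) eq

  regular-* : ∀ {r s} → Regular r → Regular s → Regular (r * s)
  regular-* {r} {s} reg reg′ t eq = reg′ t (reg (s * t) (trans (sym (*-assoc r s t)) eq))

  regular-*ʳ : ∀ {r s} → Regular (r * s) → Regular s
  regular-*ʳ {r} {s} reg t eq = reg t (begin
    r * s * t    ≈⟨ *-assoc r s t ⟩
    r * (s * t)  ≈⟨ *-congˡ eq ⟩
    r * 0#       ≈⟨ zeroʳ r ⟩
    0#           ∎)

  ¬regular-0 : ¬ (1# ≈ 0#) → ∀ {r} → r ≈ 0# → ¬ Regular r
  ¬regular-0 1≉0 r≈0 reg = 1≉0 (reg 1# (trans (*-congʳ r≈0) (zeroˡ 1#)))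

  add-sub : ∀ x y → x ≈ y + (x - y)
  add-sub x y = begin
    x              ≈⟨ +-identityʳ x ⟨
    x + 0#         ≈⟨ +-congˡ (-‿inverseˡ y) ⟨
    x + (- y + y)  ≈⟨ +-assoc x (- y) y ⟨
    (x - y) + y    ≈⟨ +-comm (x - y) y ⟩
    y + (x - y)    ∎

  -- Degree at most d in the coordinates pts i (lookup v i), witnessed by a
  -- Horner expansion in the first variable.
  data Deg {k} : ∀ {n} → (Fin n → Fin k → Carrier) → ℕ → (Vec (Fin k) n → Carrier) → Set where
    nil    : ∀ {pts d f} → Deg {n = zero} pts d f
    const  : ∀ {n pts d f g} → Deg (pts ∘ suc) d g →
             (∀ a v → f (a ∷ v) ≈ g v) → Deg {n = suc n} pts d f
    horner : ∀ {n pts d f g h} → Deg (pts ∘ suc) (suc d) g → Deg pts d h →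
             (∀ a v → f (a ∷ v) ≈ g v + pts zero a * h (a ∷ v)) → Deg {n = suc n} pts (suc d) f

  module _ {k : ℕ} where

    deg-cong : ∀ {n pts d} {f g : Vec (Fin k) n → Carrier} →
               (∀ v → f v ≈ g v) → Deg pts d f → Deg pts d g
    deg-cong f≈g nil            = nil
    deg-cong f≈g (const G e)    = const G (λ a v → trans (sym (f≈g (a ∷ v))) (e a v))
    deg-cong f≈g (horner G H e) = horner G H (λ a v → trans (sym (f≈g (a ∷ v))) (e a v))

    deg-const : ∀ {n} {pts : Fin n → Fin k → Carrier} {d} c → Deg pts d (λ _ → c)
    deg-const {zero}  c = nil
    deg-const {suc n} c = const (deg-const c) (λ _ _ → refl)

    deg-weaken : ∀ {n pts d d′} {f : Vec (Fin k) n → Carrier} → d ℕ.≤ d′ → Deg pts d f → Deg pts d′ f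
    deg-weaken d≤d′ nil                  = nil
    deg-weaken d≤d′ (const G e)          = const (deg-weaken d≤d′ G) e
    deg-weaken (s≤s d≤d′) (horner G H e) = horner (deg-weaken (s≤s d≤d′) G) (deg-weaken d≤d′ H) e

    deg-var : ∀ {n} {pts : Fin n → Fin k → Carrier} i → Deg pts 1 (λ v → pts i (lookup v i))
    deg-var {suc n} zero    = horner (deg-const 0#) (deg-const 1#)
      (λ a v → sym (trans (+-identityˡ _) (*-identityʳ _)))
    deg-var {suc n} (suc i) = const (deg-var i) (λ _ _ → refl)

    deg-shift : ∀ {n} {pts : Fin (suc n) → Fin k → Carrier} {d f} →
                Deg pts d f → Deg pts (suc d) (λ v → pts zero (head v) * f v)
    deg-shift F = horner (deg-const 0#) F (λ _ _ → sym (+-identityˡ _))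

    deg-+ : ∀ {n pts d} {f g : Vec (Fin k) n → Carrier} →
            Deg pts d f → Deg pts d g → Deg pts d (λ v → f v + g v)
    deg-+ nil nil = nil
    deg-+ (const G e) (const G′ e′) = const (deg-+ G G′) (λ a v → +-cong (e a v) (e′ a v))
    deg-+ (const G e) (horner G′ H′ e′) = horner (deg-+ G G′) H′
      (λ a v → trans (+-cong (e a v) (e′ a v)) (sym (+-assoc _ _ _)))
    deg-+ (horner G H e) (const G′ e′) = horner (deg-+ G G′) H
      (λ a v → trans (+-cong (e a v) (e′ a v))
        (solve 3 (λ g y g′ → (g :+ y) :+ g′ := (g :+ g′) :+ y) refl _ _ _))
    deg-+ (horner G H e) (horner G′ H′ e′) = horner (deg-+ G G′) (deg-+ H H′)
      (λ a v → trans (+-cong (e a v) (e′ a v))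
        (solve 5 (λ g x y g′ y′ → (g :+ x :* y) :+ (g′ :+ x :* y′) := (g :+ g′) :+ x :* (y :+ y′))
          refl _ _ _ _ _))

    mutual
      deg-* : ∀ {n pts d d′} {f g : Vec (Fin k) n → Carrier} →
              Deg pts d f → Deg pts d′ g → Deg pts (d ℕ.+ d′) (λ v → f v * g v)
      deg-* nil nil = nil
      deg-* {f = f} (const {g = g} G e) F =
        deg-cong (λ { (a ∷ v) → *-congʳ (sym (e a v)) }) (deg-tail-* G F)
      deg-* {pts = pts} (horner {g = g} {h} G H e) F =
        deg-cong (λ { (a ∷ v) → trans
            (solve 4 (λ g x h f → g :* f :+ x :* (h :* f) := (g :+ x :* h) :* f) refl _ _ _ _)
            (*-congʳ (sym (e a v))) })
          (deg-+ (deg-tail-* G F) (deg-shift (deg-* H F)))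

      -- `deg-*` peels the Horner layers of its left factor and passes each coefficient, which is
      -- free of the first variable, to this lemma, which peels the layers of the right factor.
      deg-tail-* : ∀ {n} {pts : Fin (suc n) → Fin k → Carrier} {d d′ g f} →
                   Deg (pts ∘ suc) d g → Deg pts d′ f → Deg pts (d ℕ.+ d′) (λ v → g (tail v) * f v)
      deg-tail-* G (const F e) = const (deg-* G F) (λ a v → *-congˡ (e a v))
      deg-tail-* {pts = pts} {d} {g = g} {f} G (horner {d = d′} {g = f₀} F H e) =
        ≡.subst (λ m → Deg pts m (λ v → g (tail v) * f v)) (≡.sym (ℕₚ.+-suc d d′))
          (horner (≡.subst (λ m → Deg (pts ∘ suc) m (λ v → g v * f₀ v)) (ℕₚ.+-suc d d′) (deg-* G F)) (deg-tail-* G H)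
            (λ a v → trans (*-congˡ (e a v))
              (solve 4 (λ g f x h → g :* (f :+ x :* h) := g :* f :+ x :* (g :* h)) refl _ _ _ _)))

    deg-restrict : ∀ {n} {pts : Fin (suc n) → Fin k → Carrier} {d f} →
                   Deg pts d f → ∀ b → Deg (pts ∘ suc) d (λ v → f (b ∷ v))
    deg-restrict (const G e) b = deg-cong (λ v → sym (e b v)) G
    deg-restrict {pts = pts} (horner G H e) b = deg-cong (λ v → sym (e b v))
      (deg-+ G (deg-* (deg-const {d = 0} (pts zero b)) (deg-weaken (ℕₚ.n≤1+n _) (deg-restrict H b))))

    ConstantInHead : ∀ {n} → (Vec (Fin k) (suc n) → Carrier) → Fin k → Set
    ConstantInHead f b = ∀ a v → f (a ∷ v) ≈ f (b ∷ v)

    record LinearFactor {n} (pts : Fin (suc n) → Fin k → Carrier) (d : ℕ)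
                        (f : Vec (Fin k) (suc n) → Carrier) (b : Fin k) : Set where
      constructor linearFactor
      field
        {d′}     : ℕ
        d≡       : d ≡ suc d′
        {q}      : Vec (Fin k) (suc n) → Carrier
        deg-q    : Deg pts d′ q
        division : ∀ a v → f (a ∷ v) ≈ f (b ∷ v) + (pts zero a - pts zero b) * q (a ∷ v)

    -- Synthetic division along the Horner expansion: if h = h(b) + (x - y) q, then x h - y h(b) =
    -- (x - y) (h(b) + x q). The second alternative stands for a quotient zero, kept apart because
    -- `d` may be 0 and then leaves no degree for a quotient.
    divide : ∀ {n} {pts : Fin (suc n) → Fin k → Carrier} {d f} → Deg pts d f → ∀ b →
             LinearFactor pts d f b ⊎ ConstantInHead f b
    divide (const G e) b = inj₂ (λ a v → trans (e a v) (sym (e b v)))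
    divide {pts = pts} {f = f} (horner {g = g} {h} G H e) b with divide H b
    ... | inj₂ hyp = inj₁ (linearFactor ≡.refl H λ a v →
      let x = pts zero a; y = pts zero b in begin
        f (a ∷ v)                                  ≈⟨ e a v ⟩
        g v + x * h (a ∷ v)                        ≈⟨ +-congˡ (*-congʳ (add-sub x y)) ⟩
        g v + (y + (x - y)) * h (a ∷ v)            ≈⟨ solve 4 (λ g y δ h → g :+ (y :+ δ) :* h := (g :+ y :* h) :+ δ :* h) refl _ _ _ _ ⟩
        (g v + y * h (a ∷ v)) + (x - y) * h (a ∷ v) ≈⟨ +-congʳ (trans (+-congˡ (*-congˡ (hyp a v))) (sym (e b v))) ⟩
        f (b ∷ v) + (x - y) * h (a ∷ v)            ∎)
    ... | inj₁ (linearFactor ≡.refl {q} Q div) = inj₁ (linearFactor ≡.refl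
      {q = λ v → h (b ∷ tail v) + pts zero (head v) * q v}
      (deg-+ (const (deg-restrict H b) (λ _ _ → refl)) (deg-shift Q)) λ a v →
      let x = pts zero a; y = pts zero b in begin
        f (a ∷ v)                              ≈⟨ e a v ⟩
        g v + x * h (a ∷ v)                    ≈⟨ +-congˡ (*-congˡ (div a v)) ⟩
        g v + x * (h (b ∷ v) + (x - y) * q (a ∷ v))
          ≈⟨ solve 5 (λ g x h δ q → g :+ x :* (h :+ δ :* q) := (g :+ x :* h) :+ δ :* (x :* q)) refl _ _ _ _ _ ⟩
        (g v + x * h (b ∷ v)) + (x - y) * (x * q (a ∷ v)) ≈⟨ +-congʳ (+-congˡ (*-congʳ (add-sub x y))) ⟩
        (g v + (y + (x - y)) * h (b ∷ v)) + (x - y) * (x * q (a ∷ v))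
          ≈⟨ solve 6 (λ g y δ h x q → (g :+ (y :+ δ) :* h) :+ δ :* (x :* q) := (g :+ y :* h) :+ δ :* (h :+ x :* q)) refl _ _ _ _ _ _ ⟩
        (g v + y * h (b ∷ v)) + (x - y) * (h (b ∷ v) + x * q (a ∷ v)) ≈⟨ +-congʳ (sym (e b v)) ⟩
        f (b ∷ v) + (x - y) * (h (b ∷ v) + x * q (a ∷ v)) ∎)

    -- `q` is f divided by the linear factors at the heads in `L`. In place of the factorisation
    -- only its consequences are kept: `q` is regular wherever f is, and off `L` it is zero wherever
    -- f is.
    record Quotient {n} (pts : Fin (suc n) → Fin k → Carrier) (d : ℕ)
                    (f : Vec (Fin k) (suc n) → Carrier) (L : List (Fin k)) : Set where
      field
        {d′}    : ℕ
        d≡      : d ≡ length L ℕ.+ d′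
        {q}     : Vec (Fin k) (suc n) → Carrier
        deg-q   : Deg pts d′ q
        regular : ∀ a v → Regular (f (a ∷ v)) → Regular (q (a ∷ v))
        vanish  : ∀ a v → a ∉ L → f (a ∷ v) ≈ 0# → q (a ∷ v) ≈ 0#

    divideAll : ¬ (1# ≈ 0#) → ∀ {n} {pts : Fin (suc n) → Fin k → Carrier} →
                (∀ {a b} → a ≢ b → Regular (pts zero a - pts zero b)) →
                ∀ {d f} → Deg pts d f → ∀ L → Unique L →
                (∀ {b} → b ∈ L → ∀ v → f (b ∷ v) ≈ 0#) →
                ∀ a₀ v₀ → Regular (f (a₀ ∷ v₀)) → Quotient pts d f L
    divideAll 1≉0 diff F [] _ zeros a₀ v₀ reg = record
      { d≡ = ≡.refl ; deg-q = F ; regular = λ _ _ → id ; vanish = λ _ _ _ → id }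
    divideAll 1≉0 {pts = pts} diff {d} {f} F (b ∷ L) (b∉ ∷ uniq) zeros a₀ v₀ reg
      with record { d′ = d′ ; d≡ = ≡.refl ; q = q ; deg-q = Q ; regular = R ; vanish = V }
             ← divideAll 1≉0 diff F L uniq (zeros ∘ there) a₀ v₀ reg
      -- `b` is not among the heads already divided out, so the quotient by those still vanishes
      -- there.
      with qb≈0 ← (λ v → V b v (λ b∈L → All.lookup b∉ b∈L ≡.refl) (zeros (here ≡.refl) v))
      with divide Q b
    -- A quotient constant in the head would vanish at `a₀ ∷ v₀` as it does at `b ∷ v₀`, against its
    -- regularity there.
    ... | inj₂ hyp = contradiction (R a₀ v₀ reg) (¬regular-0 1≉0 (trans (hyp a₀ v₀) (qb≈0 v₀)))
    ... | inj₁ (linearFactor {e} ≡.refl {r} deg-r div) = record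
      { d≡ = ℕₚ.+-suc (length L) e
      ; deg-q = deg-r
      ; regular = λ a v reg′ → regular-*ʳ (regular-cong (eq a v) (R a v reg′))
      ; vanish = λ a v a∉ fa≈0 → diff (a∉ ∘ here) _
          (trans (sym (eq a v)) (V a v (a∉ ∘ there) fa≈0))
      }
      where
      eq : ∀ a v → q (a ∷ v) ≈ (pts zero a - pts zero b) * r (a ∷ v)
      eq a v = trans (div a v) (trans (+-congʳ (qb≈0 v)) (+-identityˡ _))

-- The Alon-Füredi theorem and the numerical inequality behind it

suc-^ : ∀ s m → s ℕ.≤ m → suc m ℕ.^ s ℕ.≤ suc s ℕ.* m ℕ.^ s
suc-^ zero    m _   = s≤s z≤n
suc-^ (suc s) m s<m = begin
  suc m ℕ.* suc m ℕ.^ s             ≤⟨ ℕₚ.*-monoʳ-≤ (suc m) (suc-^ s m (ℕₚ.<⇒≤ s<m)) ⟩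
  suc m ℕ.* (suc s ℕ.* m ℕ.^ s)     ≡⟨ ℕₚ.*-assoc (suc m) (suc s) (m ℕ.^ s) ⟨
  (suc m ℕ.* suc s) ℕ.* m ℕ.^ s     ≤⟨ ℕₚ.*-monoˡ-≤ (m ℕ.^ s) coefficient ⟩
  (suc (suc s) ℕ.* m) ℕ.* m ℕ.^ s   ≡⟨ ℕₚ.*-assoc (suc (suc s)) m (m ℕ.^ s) ⟩
  suc (suc s) ℕ.* (m ℕ.* m ℕ.^ s)   ∎
  where
  open ℕₚ.≤-Reasoning
  -- Raising s by one multiplies the left side by m + 1 and the right side by m (s + 2) / (s + 1);
  -- this is where s < m enters.
  coefficient : suc m ℕ.* suc s ℕ.≤ suc (suc s) ℕ.* m
  coefficient = begin
    suc s ℕ.+ m ℕ.* suc s    ≡⟨ ≡.cong (suc s ℕ.+_) (ℕₚ.*-comm m (suc s)) ⟩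
    suc s ℕ.+ suc s ℕ.* m    ≤⟨ ℕₚ.+-monoˡ-≤ (suc s ℕ.* m) s<m ⟩
    m ℕ.+ suc s ℕ.* m        ∎

-- With w + 1 nonempty slices, b empty ones and k = w + b, this yields (k + 1)^k ≤ (w + 1)^k (k +
-- 1)^b, the gain that Alon-Füredi needs from one coordinate. By `suc-^`, enlarging b by one
-- multiplies the left side by at most w + 1.
^-exchange : ∀ w b → (suc w ℕ.+ b) ℕ.^ w ℕ.≤ suc w ℕ.^ (w ℕ.+ b)
^-exchange w zero    rewrite ℕₚ.+-identityʳ w = ℕₚ.≤-refl
^-exchange w (suc b) rewrite ℕₚ.+-suc w b = begin
  suc (suc w ℕ.+ b) ℕ.^ w            ≤⟨ suc-^ w (suc w ℕ.+ b) (ℕₚ.≤-trans (ℕₚ.n≤1+n w) (ℕₚ.m≤m+n (suc w) b)) ⟩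
  suc w ℕ.* (suc w ℕ.+ b) ℕ.^ w      ≤⟨ ℕₚ.*-monoʳ-≤ (suc w) (^-exchange w b) ⟩
  suc w ℕ.* suc w ℕ.^ (w ℕ.+ b)      ∎
  where open ℕₚ.≤-Reasoning

^-distribʳ-* : ∀ m n o → (m ℕ.* n) ℕ.^ o ≡ m ℕ.^ o ℕ.* n ℕ.^ o
^-distribʳ-* m n zero    = ≡.refl
^-distribʳ-* m n (suc o) = ≡.trans (≡.cong (m ℕ.* n ℕ.*_) (^-distribʳ-* m n o)) (ℕ*.interchange m n (m ℕ.^ o) (n ℕ.^ o))

countVec : (n : ℕ) {k : ℕ} → (Vec (Fin k) n → Bool) → ℕ
countVec zero    P = if P [] then 1 else 0
countVec (suc n) P = sumFin (λ a → countVec n (λ v → P (a ∷ v)))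

≤-sumFin : ∀ {m} (F : Fin m → ℕ) i → F i ℕ.≤ sumFin F
≤-sumFin F zero    = ℕₚ.m≤m+n _ _
≤-sumFin F (suc i) = ℕₚ.≤-trans (≤-sumFin (F ∘ suc) i) (ℕₚ.m≤n+m _ _)

countVec-pos : ∀ {n k} (P : Vec (Fin k) n → Bool) v → P v ≡ true → 0 ℕ.< countVec n P
countVec-pos P []      eq rewrite eq = s≤s z≤n
countVec-pos P (a ∷ v) eq = ℕₚ.<-≤-trans (countVec-pos (λ v → P (a ∷ v)) v eq)
  (≤-sumFin (λ a → countVec _ (λ v → P (a ∷ v))) a)

countVec-witness : ∀ {n k} (P : Vec (Fin k) n → Bool) → countVec n P ≢ 0 → ∃ λ v → P v ≡ true
countVec-witness {zero} P ≢0 with P [] in eq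
... | true  = [] , eq
... | false = contradiction ≡.refl ≢0
countVec-witness {suc n} {k} P ≢0 = search (λ a → countVec n (λ v → P (a ∷ v)))
    (λ a ≢0 → let v , eq = countVec-witness _ ≢0 in a ∷ v , eq) ≢0
  where
  search : ∀ {m} {A : Set} (F : Fin m → ℕ) → (∀ a → F a ≢ 0 → A) → sumFin F ≢ 0 → A
  search {zero}  F found ≢0 = contradiction ≡.refl ≢0
  search {suc m} F found ≢0 with F zero in eq
  ... | zero  = search (F ∘ suc) (found ∘ suc) ≢0
  ... | suc _ = found zero (λ eq′ → ℕₚ.1+n≢0 (≡.trans (≡.sym eq) eq′))

sumFin-list : ∀ {m} (F : Fin m → ℕ) → sumFin F ≡ sum (List.map F (List.allFin m))
sumFin-list F = ≡.trans (tab F) (≡.cong sum (≡.sym (Listₚ.map-tabulate id F)))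
  where
  tab : ∀ {m} (F : Fin m → ℕ) → sumFin F ≡ sum (List.tabulate F)
  tab {zero}  F = ≡.refl
  tab {suc m} F = ≡.cong (F zero ℕ.+_) (tab (F ∘ suc))

zeros : {A : Set} → (A → ℕ) → List A → List A
zeros N = List.filter (λ a → N a ℕ.≟ 0)

module _ {A : Set} (N : A → ℕ) where

  drop-zero : ∀ {x} xs w → N x ≡ 0 → length xs ≡ w ℕ.+ length (zeros N xs) →
              suc (length xs) ≡ w ℕ.+ length (zeros N (x ∷ xs))
  drop-zero xs w Nx≡0 len rewrite Listₚ.filter-accept (λ a → N a ℕ.≟ 0) {xs = xs} Nx≡0 =
    ≡.trans (≡.cong suc len) (≡.sym (ℕₚ.+-suc w _))

  keep : ∀ {x} xs w → N x ≢ 0 → length xs ≡ w ℕ.+ length (zeros N xs) →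
         suc (length xs) ≡ suc w ℕ.+ length (zeros N (x ∷ xs))
  keep xs w Nx≢0 len rewrite Listₚ.filter-reject (λ a → N a ℕ.≟ 0) {xs = xs} Nx≢0 = ≡.cong suc len

  all-zeros : ∀ xs → All (λ a → N a ≡ 0) xs → length xs ≡ length (zeros N xs)
  all-zeros xs all = ≡.sym (≡.cong length (Listₚ.filter-all (λ a → N a ℕ.≟ 0) all))

-- w is the number of nonzero values and m their minimum.
least-nonzero : {A : Set} (Q : ℕ → Set) (N : A → ℕ) → (∀ a → N a ≢ 0 → Q (N a)) → ∀ xs →
  ∃₂ λ w m → length xs ≡ w ℕ.+ length (zeros N xs) × w ℕ.* m ℕ.≤ sum (List.map N xs) ×
    (All (λ a → N a ≡ 0) xs ⊎ (0 ℕ.< w × Q m))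
least-nonzero Q N q [] = 0 , 0 , ≡.refl , z≤n , inj₁ []
least-nonzero Q N q (x ∷ xs) with least-nonzero Q N q xs | N x ℕ.≟ 0
... | w , m , len , ≤Σ , inj₁ all        | yes Nx≡0 =
  w , m , drop-zero N xs w Nx≡0 len , ℕₚ.≤-trans ≤Σ (ℕₚ.m≤n+m _ _) , inj₁ (Nx≡0 ∷ all)
... | w , m , len , ≤Σ , inj₂ (pos , qm) | yes Nx≡0 =
  w , m , drop-zero N xs w Nx≡0 len , ℕₚ.≤-trans ≤Σ (ℕₚ.m≤n+m _ _) , inj₂ (pos , qm)
... | w , m , len , ≤Σ , inj₁ all        | no Nx≢0 =
  1 , N x , keep N xs 0 Nx≢0 (all-zeros N xs all) , ℕₚ.+-monoʳ-≤ (N x) z≤n , inj₂ (s≤s z≤n , q x Nx≢0)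
... | w , m , len , ≤Σ , inj₂ (pos , qm) | no Nx≢0 with ℕₚ.≤-total m (N x)
...   | inj₁ m≤Nx = suc w , m , keep N xs w Nx≢0 len , ℕₚ.+-mono-≤ m≤Nx ≤Σ , inj₂ (s≤s z≤n , qm)
...   | inj₂ Nx≤m = suc w , N x , keep N xs w Nx≢0 len ,
  ℕₚ.+-monoʳ-≤ (N x) (ℕₚ.≤-trans (ℕₚ.*-monoʳ-≤ w Nx≤m) ≤Σ) , inj₂ (s≤s z≤n , q x Nx≢0)

module AlonFüredi (R : CommutativeRing 0ℓ 0ℓ) where
  open CommutativeRing R using (Carrier; _≈_; _-_; 0#; 1#)
  open Polynomials R

  record Indicator {n k} (pts : Fin n → Fin k → Carrier) (d : ℕ) (P : Vec (Fin k) n → Bool) : Set where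
    field
      {poly}  : Vec (Fin k) n → Carrier
      deg     : Deg pts d poly
      regular : ∀ v → P v ≡ true → Regular (poly v)
      vanish  : ∀ v → P v ≡ false → poly v ≈ 0#

  open Indicator

  -- The customary bound q^(n - d/(q - 1)) for q = k + 1 points on each side, raised to the power k.
  -- By induction on n: the linear factors at the b heads with an empty slice can be divided out, so
  -- every other slice satisfies the bound with degree d - b; the smallest of these counts is then
  -- multiplied by their number.
  alonFüredi : ¬ (1# ≈ 0#) → ∀ {n k} {pts : Fin n → Fin (suc k) → Carrier} →
    (∀ i {a b} → a ≢ b → Regular (pts i a - pts i b)) →
    ∀ {d} P → Indicator pts d P → (∃ λ v → P v ≡ true) →
    suc k ℕ.^ (n ℕ.* k) ℕ.≤ countVec n P ℕ.^ k ℕ.* suc k ℕ.^ d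
  alonFüredi 1≉0 {zero} {k} diff {d} P ind ([] , eq) rewrite eq | ℕₚ.^-zeroˡ k =
    ℕₚ.≤-trans (ℕₚ.m^n>0 (suc k) d) (ℕₚ.≤-reflexive (≡.sym (ℕₚ.+-identityʳ _)))
  alonFüredi 1≉0 {suc n} {k} {pts} diff {d} P ind (a₀ ∷ v₀ , eq) = conclude (least-nonzero Q N good (List.allFin (suc k)))
    where
    open ℕₚ.≤-Reasoning
    N : Fin (suc k) → ℕ
    N a = countVec n (λ v → P (a ∷ v))
    bad : List (Fin (suc k))
    bad = zeros N (List.allFin (suc k))
    bad⇒N≡0 : ∀ {b} → b ∈ bad → N b ≡ 0
    bad⇒N≡0 b∈ = proj₂ (∈-filter⁻ (λ a → N a ℕ.≟ 0) {xs = List.allFin (suc k)} b∈)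
    bad-false : ∀ {b} → b ∈ bad → ∀ v → P (b ∷ v) ≡ false
    bad-false {b} b∈ v with P (b ∷ v) in eq
    ... | false = ≡.refl
    ... | true  = contradiction (≡.subst (0 ℕ.<_) (bad⇒N≡0 b∈) (countVec-pos (λ v → P (b ∷ v)) v eq)) λ ()
    open Quotient (divideAll 1≉0 (diff zero) (deg ind) bad
      (filter⁺ (λ a → N a ℕ.≟ 0) (allFin⁺ (suc k)))
      (λ b∈ v → vanish ind _ (bad-false b∈ v)) a₀ v₀ (regular ind _ eq)) renaming (regular to q-regular; vanish to q-vanish)
    Q : ℕ → Set
    Q m = suc k ℕ.^ (n ℕ.* k) ℕ.≤ m ℕ.^ k ℕ.* suc k ℕ.^ d′
    good : ∀ a → N a ≢ 0 → Q (N a)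
    good a Na≢0 = alonFüredi 1≉0 (diff ∘ suc) (λ v → P (a ∷ v)) (record
      { deg = deg-restrict deg-q a
      ; regular = λ v eq → q-regular a v (regular ind _ eq)
      ; vanish = λ v eq → q-vanish a v (Na≢0 ∘ bad⇒N≡0) (vanish ind _ eq)
      }) (countVec-witness _ Na≢0)
    conclude : (∃₂ λ w m → length (List.allFin (suc k)) ≡ w ℕ.+ length bad ×
                 w ℕ.* m ℕ.≤ sum (List.map N (List.allFin (suc k))) ×
                 (All (λ a → N a ≡ 0) (List.allFin (suc k)) ⊎ (0 ℕ.< w × Q m))) →
               suc k ℕ.^ (suc n ℕ.* k) ℕ.≤ countVec (suc n) P ℕ.^ k ℕ.* suc k ℕ.^ d
    conclude (w , m , len , ≤Σ , inj₁ all) =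
      contradiction (≡.subst (0 ℕ.<_) (All.lookup all (∈-allFin a₀)) (countVec-pos (λ v → P (a₀ ∷ v)) v₀ eq)) λ ()
    conclude (suc w , m , len , ≤Σ , inj₂ (_ , qm)) = begin
      suc k ℕ.^ (k ℕ.+ n ℕ.* k)                 ≡⟨ ℕₚ.^-distribˡ-+-* (suc k) k (n ℕ.* k) ⟩
      suc k ℕ.^ k ℕ.* suc k ℕ.^ (n ℕ.* k)       ≤⟨ ℕₚ.*-mono-≤ k^k qm ⟩
      (suc w ℕ.^ k ℕ.* K^b) ℕ.* (m ℕ.^ k ℕ.* suc k ℕ.^ d′)
        ≡⟨ ℕ*.interchange (suc w ℕ.^ k) K^b (m ℕ.^ k) (suc k ℕ.^ d′) ⟩
      (suc w ℕ.^ k ℕ.* m ℕ.^ k) ℕ.* (K^b ℕ.* suc k ℕ.^ d′)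
        ≡⟨ ≡.cong₂ ℕ._*_ (^-distribʳ-* (suc w) m k) (ℕₚ.^-distribˡ-+-* (suc k) (length bad) d′) ⟨
      (suc w ℕ.* m) ℕ.^ k ℕ.* suc k ℕ.^ (length bad ℕ.+ d′)
        ≤⟨ ℕₚ.*-mono-≤ (ℕₚ.^-monoˡ-≤ k (ℕₚ.≤-trans ≤Σ (ℕₚ.≤-reflexive (≡.sym (sumFin-list N)))))
             (ℕₚ.≤-reflexive (≡.cong (suc k ℕ.^_) (≡.sym d≡))) ⟩
      countVec (suc n) P ℕ.^ k ℕ.* suc k ℕ.^ d  ∎
      where
      K^b = suc k ℕ.^ length bad
      k≡ : k ≡ w ℕ.+ length bad
      k≡ = ℕₚ.suc-injective (≡.trans (≡.sym (Listₚ.length-tabulate id)) len)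
      k^k : suc k ℕ.^ k ℕ.≤ suc w ℕ.^ k ℕ.* K^b
      k^k = begin
        suc k ℕ.^ k                            ≡⟨ ≡.cong (suc k ℕ.^_) k≡ ⟩
        suc k ℕ.^ (w ℕ.+ length bad)           ≡⟨ ℕₚ.^-distribˡ-+-* (suc k) w (length bad) ⟩
        suc k ℕ.^ w ℕ.* K^b                    ≡⟨ ≡.cong (λ x → suc x ℕ.^ w ℕ.* K^b) k≡ ⟩
        (suc w ℕ.+ length bad) ℕ.^ w ℕ.* K^b   ≤⟨ ℕₚ.*-monoˡ-≤ K^b (^-exchange w (length bad)) ⟩
        suc w ℕ.^ (w ℕ.+ length bad) ℕ.* K^b   ≡⟨ ≡.cong (λ x → suc w ℕ.^ x ℕ.* K^b) k≡ ⟨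
        suc w ℕ.^ k ℕ.* K^b                    ∎

-- Polynomials vanishing exactly at the conflicts

-- The additive part of a field with k elements; products of members may lie outside. `sub a` is b ↦
-- a - b on the indices, given as a permutation so that products over the group can be reindexed by
-- it.
record RegularSubgroup (R : CommutativeRing 0ℓ 0ℓ) (k : ℕ) : Set where
  open CommutativeRing R hiding (zero)
  open MonoidSum +-commutativeMonoid using () renaming (sum to ∑)
  field
    ι       : Fin k → Carrier
    regular : ∀ {a b} → a ≢ b → Polynomials.Regular R (ι a - ι b)
    sub     : Fin k → Permutation′ k
    ι-sub   : ∀ a b → ι (sub a ⟨$⟩ʳ b) ≈ ι a - ι b
    ∑ι≈0    : ∑ ι ≈ 0#

module Indicators (R : CommutativeRing 0ℓ 0ℓ) where
  open CommutativeRing R hiding (zero)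
  open RingProperties ring
  open SetoidReasoning setoid
  open SemiringSolver commutativeSemiring using (solve; _:=_; _:+_; _:*_)
  open Exp semiring using (_^_)
  open SemiringSum semiring using (*-distribʳ-sum)
  module ∑ = MonoidSum +-commutativeMonoid
  module ∏ = MonoidSum *-commutativeMonoid
  open ∑ using () renaming (sum to ∑)
  open ∏ using () renaming (sum to ∏)
  open Polynomials R
  open AlonFüredi R
  open Indicator

  private variable
    n k d d′ : ℕ
    pts : Fin n → Fin k → Carrier

  indicator-cong : {P Q : Vec (Fin k) n → Bool} → (∀ v → P v ≡ Q v) → Indicator pts d P → Indicator pts d Q
  indicator-cong P≗Q ind = record
    { deg = deg ind
    ; regular = λ v eq → regular ind v (≡.trans (P≗Q v) eq)
    ; vanish = λ v eq → vanish ind v (≡.trans (P≗Q v) eq)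
    }

  indicator-true : Indicator pts 0 (λ _ → true)
  indicator-true = record { deg = deg-const 1# ; regular = λ _ _ → regular-1 ; vanish = λ _ () }

  indicator-∧ : ∀ {P Q} → Indicator pts d P → Indicator pts d′ Q → Indicator pts (d ℕ.+ d′) (λ v → P v ∧ Q v)
  indicator-∧ {pts = pts} {P = P} {Q} I J = record { deg = deg-* (deg I) (deg J) ; regular = reg ; vanish = van }
    where
    reg : ∀ v → P v ∧ Q v ≡ true → Regular (poly I v * poly J v)
    reg v eq with P v in p | Q v in q
    ... | true | true = regular-* (regular I v p) (regular J v q)
    van : ∀ v → P v ∧ Q v ≡ false → poly I v * poly J v ≈ 0#
    van v eq with P v in p | Q v in q
    ... | false | _     = trans (*-congʳ (vanish I v p)) (zeroˡ _)
    ... | true  | false = trans (*-congˡ (vanish J v q)) (zeroʳ _)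

  indicator-allFin : ∀ {m} {e : Fin m → ℕ} {P : Fin m → Vec (Fin k) n → Bool} →
    (∀ i → Indicator pts (e i) (P i)) → Indicator pts (sumFin e) (λ v → allFin (λ i → P i v))
  indicator-allFin {m = zero}  I = indicator-true
  indicator-allFin {m = suc m} I = indicator-∧ (I zero) (indicator-allFin (I ∘ suc))

  deg-^ : ∀ {f} → Deg pts 1 f → ∀ m → Deg pts m (λ v → f v ^ m)
  deg-^ F zero    = deg-const 1#
  deg-^ F (suc m) = deg-* F (deg-^ F m)

  deg-∑ : ∀ {m} {f : Fin m → Vec (Fin k) n → Carrier} → (∀ i → Deg pts d (f i)) → Deg pts d (λ v → ∑ (λ i → f i v))
  deg-∑ {m = zero}  F = deg-const 0#
  deg-∑ {m = suc m} F = deg-+ (F zero) (deg-∑ (F ∘ suc))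

  deg-scale : ∀ {f} c → Deg pts d f → Deg pts d (λ v → c * f v)
  deg-scale c F = deg-* (deg-const {d = 0} c) F

  deg-- : ∀ {f g : Vec (Fin k) n → Carrier} → Deg pts d f → Deg pts d g → Deg pts d (λ v → f v - g v)
  deg-- {g = g} F G = deg-+ F (deg-cong (λ v → -1*x≈-x (g v)) (deg-scale (- 1#) G))

  -- The leading power is separated because `twisted-edge` cancels it; what remains has degree m,
  -- one less than the number of factors.
  record Monic {n k} (pts : Fin n → Fin k → Carrier) (X : Vec (Fin k) n → Carrier) {m} (c : Fin (suc m) → Carrier) : Set where
    field
      {rest}   : Vec (Fin k) n → Carrier
      deg-rest : Deg pts m rest
      expand   : ∀ v → ∏ (λ j → X v - c j) ≈ X v ^ suc m + rest v
  open Monic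

  monic : ∀ {X} → Deg pts 1 X → ∀ {m} (c : Fin (suc m) → Carrier) → Monic pts X c
  monic {X = X} F {zero} c = record
    { deg-rest = deg-const (- c zero)
    ; expand = λ v → trans (*-identityʳ _) (+-congʳ (sym (*-identityʳ _)))
    }
  monic {X = X} F {suc m} c with M ← monic F (c ∘ suc) = record
    { deg-rest = deg-+ (deg-* F (deg-rest M)) (deg-scale (- c zero) (deg-+ (deg-^ F (suc m)) (deg-weaken (ℕₚ.n≤1+n m) (deg-rest M))))
    ; expand = λ v → trans (*-congˡ (expand M v))
        (solve 4 (λ x c y r → (x :+ c) :* (y :+ r) := x :* y :+ (x :* r :+ c :* (y :+ r))) refl
          (X v) (- c zero) (X v ^ suc m) (rest M v))
    }

  ∏-zero : ∀ {m} (t : Fin m → Carrier) i → t i ≈ 0# → ∏ t ≈ 0#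
  ∏-zero {suc m} t i eq = trans (∏.sum-remove t) (trans (*-congʳ eq) (zeroˡ _))

  regular-∏ : ∀ {m} (t : Fin m → Carrier) → (∀ i → Regular (t i)) → Regular (∏ t)
  regular-∏ {zero}  t reg = regular-1
  regular-∏ {suc m} t reg = regular-* (reg zero) (regular-∏ (t ∘ suc) (reg ∘ suc))

  x≈y⇒x-y≈0 : ∀ {x y} → x ≈ y → x - y ≈ 0#
  x≈y⇒x-y≈0 {y = y} eq = trans (+-congʳ eq) (-‿inverseʳ y)

  *-distribˡ-- : ∀ c x y → c * x - c * y ≈ c * (x - y)
  *-distribˡ-- c x y = trans (+-congˡ (-‿distribʳ-* c y)) (sym (distribˡ c x (- y)))

  -- `J` is k - 3. Thus `suc J` is the degree k - 2 of an edge off the forest, and `suc (suc J)` the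
  -- number of colours other than a given one.
  module Edges (1≉0 : ¬ (1# ≈ 0#)) {J : ℕ} (A : RegularSubgroup R (suc (suc (suc J)))) where
    open RegularSubgroup A renaming (regular to ι-regular)

    ι-injective : ∀ {a b} → ι a ≈ ι b → a ≡ b
    ι-injective {a} {b} eq with a Fin.≟ b
    ... | yes a≡b = a≡b
    ... | no  a≢b = contradiction (ι-regular a≢b) (¬regular-0 1≉0 (x≈y⇒x-y≈0 eq))

    others : Fin (suc (suc (suc J))) → Fin (suc (suc J)) → Carrier
    others a j = ι (punchIn a j)

    -- The index of the zero of R; the colour `zero` is just some member to subtract from itself.
    z : Fin (suc (suc (suc J)))
    z = sub zero ⟨$⟩ʳ zero

    sub-self : ∀ c → sub c ⟨$⟩ʳ c ≡ z
    sub-self c = ι-injective (trans (self c) (sym (self zero)))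
      where
      self : ∀ a → ι (sub a ⟨$⟩ʳ a) ≈ 0#
      self a = trans (ι-sub a a) (-‿inverseʳ (ι a))

    C : Carrier
    C = ∏ (others z)

    -- The differences ι c - ι b over b ≠ c run through the nonzero elements of the subgroup.
    ∏-differences : ∀ c → ∏ (λ j → ι c - others c j) ≈ C
    ∏-differences c = begin
      ∏ (λ j → ι c - others c j)                            ≈⟨ ∏.sum-cong-≋ (λ j → sym (ι-sub c (punchIn c j))) ⟩
      ∏ (λ j → ι (sub c ⟨$⟩ʳ punchIn c j))                  ≡⟨ ∏.sum-cong-≗ (λ j → ≡.cong ι (Perm.punchIn-permute (sub c) c j)) ⟩
      ∏ (λ j → others (sub c ⟨$⟩ʳ c) (Perm.remove c (sub c) ⟨$⟩ʳ j)) ≈⟨ ∏.sum-permute (others (sub c ⟨$⟩ʳ c)) (Perm.remove c (sub c)) ⟨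
      ∏ (others (sub c ⟨$⟩ʳ c))                             ≡⟨ ≡.cong (λ a → ∏ (others a)) (sub-self c) ⟩
      C                                                     ∎

    regular-C : Regular C
    regular-C = regular-cong (∏-differences zero)
      (regular-∏ _ (λ j → ι-regular (λ eq → Finₚ.punchInᵢ≢i zero j (≡.sym eq))))

    -- The term at a ≠ c contains the factor ι c - ι c. The denominators of the usual interpolation
    -- formula all equal `C` by `∏-differences`, so one multiplication by `C` clears them.
    lagrange : ∀ (w : Fin (suc (suc (suc J))) → Carrier) c → ∑ (λ a → w a * ∏ (λ j → ι c - others a j)) ≈ C * w c
    lagrange w c = begin
      ∑ t                                        ≈⟨ ∑.sum-remove {i = c} t ⟩
      t c + ∑ (λ j → t (punchIn c j))            ≈⟨ +-cong (*-congˡ (∏-differences c)) (∑.sum-cong-≋ vanishes) ⟩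
      w c * C + ∑ {suc (suc J)} (λ j → 0#)       ≈⟨ +-congˡ (∑.sum-replicate-zero (suc (suc J))) ⟩
      w c * C + 0#                               ≈⟨ trans (+-identityʳ _) (*-comm _ _) ⟩
      C * w c                                    ∎
      where
      t : Fin (suc (suc (suc J))) → Carrier
      t a = w a * ∏ (λ j → ι c - others a j)
      vanishes : ∀ j → t (punchIn c j) ≈ 0#
      vanishes j = trans (*-congˡ (∏-zero (λ i → ι c - others (punchIn c j) i) (punchOut neq) (x≈y⇒x-y≈0 (reflexive (≡.cong ι (≡.sym (Finₚ.punchIn-punchOut neq))))))) (zeroʳ _)
        where
        neq : punchIn c j ≢ c
        neq = Finₚ.punchInᵢ≢i c j

    module _ {n} (π : Fin n → Permutation′ (suc (suc (suc J)))) where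

      -- The renaming enters the coordinates of the grid rather than the colourings, so the
      -- predicate whose solutions are counted remains `isProper L`.
      renamed : Fin n → Fin (suc (suc (suc J))) → Carrier
      renamed i a = ι (π i ⟨$⟩ʳ a)

      regular-renamed : ∀ i {a b} → a ≢ b → Regular (renamed i a - renamed i b)
      regular-renamed i a≢b = ι-regular (λ eq → a≢b
        (≡.trans (≡.sym (Perm.inverseˡ (π i))) (≡.trans (≡.cong (π i Perm.⟨$⟩ˡ_) eq) (Perm.inverseˡ (π i)))))

      differ : (θ : Permutation′ (suc (suc (suc J)))) (u w : Fin n) → Vec (Fin (suc (suc (suc J)))) n → Bool
      differ θ u w v = not ⌊ (θ ⟨$⟩ʳ (π u ⟨$⟩ʳ lookup v u)) Fin.≟ (π w ⟨$⟩ʳ lookup v w) ⌋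

      scaled-difference : ∀ {d θ u w c f} → Regular c → Deg renamed d f →
        (∀ v → f v ≈ c * (ι (π w ⟨$⟩ʳ lookup v w) - ι (θ ⟨$⟩ʳ (π u ⟨$⟩ʳ lookup v u)))) →
        Indicator renamed d (differ θ u w)
      scaled-difference {θ = θ} {u} {w} {c} {f} reg F eq = record { deg = F ; regular = R′ ; vanish = V′ }
        where
        R′ : ∀ v → differ θ u w v ≡ true → Regular (f v)
        R′ v ok with (θ ⟨$⟩ʳ (π u ⟨$⟩ʳ lookup v u)) Fin.≟ (π w ⟨$⟩ʳ lookup v w)
        ... | no ≢ = regular-cong (sym (eq v)) (regular-* reg (ι-regular (≢ ∘ ≡.sym)))
        V′ : ∀ v → differ θ u w v ≡ false → f v ≈ 0#
        V′ v ok with (θ ⟨$⟩ʳ (π u ⟨$⟩ʳ lookup v u)) Fin.≟ (π w ⟨$⟩ʳ lookup v w)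
        ... | yes ≡ = trans (eq v) (trans (*-congˡ (x≈y⇒x-y≈0 (reflexive (≡.cong ι (≡.sym ≡))))) (zeroʳ c))

      straight-edge : ∀ {θ} → (∀ a → θ ⟨$⟩ʳ a ≡ a) → ∀ u w → Indicator renamed 1 (differ θ u w)
      straight-edge {θ} id≗ u w = scaled-difference {θ = θ} {u} {w} regular-1 (deg-- (deg-var w) (deg-var u)) λ v →
        trans (+-congˡ (-‿cong (reflexive (≡.cong ι (≡.sym (id≗ _)))))) (sym (*-identityˡ _))

      -- Lagrange interpolation of θ; the coefficient of X^(k-1) is the sum of
      -- the whole subgroup, which is zero, so that degree k-2 suffices.
      twisted-edge : ∀ θ u w → Indicator renamed (suc J) (differ θ u w)
      twisted-edge θ u w = scaled-difference {θ = θ} {u} {w} regular-C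
          (deg-- (deg-scale C (deg-weaken (s≤s z≤n) (deg-var w))) (deg-∑ (λ a → deg-scale (ι (θ ⟨$⟩ʳ a)) (deg-rest (M a)))))
          (λ v → trans (+-congˡ (-‿cong (sym (interpolate v)))) (*-distribˡ-- C _ _))
        where
        X : Vec (Fin (suc (suc (suc J)))) n → Carrier
        X v = ι (π u ⟨$⟩ʳ lookup v u)
        M : ∀ a → Monic renamed X (others a)
        M a = monic (deg-var u) (others a)
        w′ : Fin (suc (suc (suc J))) → Carrier
        w′ a = ι (θ ⟨$⟩ʳ a)
        interpolate : ∀ v → C * w′ (π u ⟨$⟩ʳ lookup v u) ≈ ∑ (λ a → w′ a * rest (M a) v)
        interpolate v = begin
          C * w′ (π u ⟨$⟩ʳ lookup v u)                                ≈⟨ lagrange w′ _ ⟨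
          ∑ (λ a → w′ a * ∏ (λ j → X v - others a j))                 ≈⟨ ∑.sum-cong-≋ (λ a → trans (*-congˡ (expand (M a) v)) (distribˡ (w′ a) X^ (rest (M a) v))) ⟩
          ∑ (λ a → w′ a * X^ + w′ a * rest (M a) v)                   ≈⟨ ∑.∑-distrib-+ (λ a → w′ a * X^) (λ a → w′ a * rest (M a) v) ⟩
          ∑ (λ a → w′ a * X^) + ∑ (λ a → w′ a * rest (M a) v)         ≈⟨ +-congʳ (*-distribʳ-sum X^ w′) ⟨
          ∑ w′ * X^ + ∑ (λ a → w′ a * rest (M a) v)                   ≈⟨ +-congʳ (*-congʳ (trans (sym (∑.sum-permute ι θ)) ∑ι≈0)) ⟩
          0# * X^ + ∑ (λ a → w′ a * rest (M a) v)                     ≈⟨ trans (+-congʳ (zeroˡ X^)) (+-identityˡ _) ⟩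
          ∑ (λ a → w′ a * rest (M a) v)                               ∎
          where X^ = X v ^ suc (suc J)

-- Power series over the integers modulo p

module PowerSeries (K : CommutativeRing 0ℓ 0ℓ) where
  open CommutativeRing K hiding (zero)
  open SetoidReasoning setoid
  open SemiringSolver commutativeSemiring using (solve; _:=_; _:+_; _:*_)
  private module S = CommutativeRing (Pointwise.commutativeRing ℕ K)

  Series : Set
  Series = ℕ → Carrier

  infix  4 _≋_
  infixl 7 _⊛_

  _≋_ : Series → Series → Set
  f ≋ g = ∀ n → f n ≈ g n

  shift : Series → Series
  shift f n = f (suc n)

  -- The Cauchy product, by recursion along f = f 0 + X (shift f).
  _⊛_ : Series → Series → Series
  (f ⊛ g) zero    = f 0 * g 0
  (f ⊛ g) (suc n) = f 0 * g (suc n) + (shift f ⊛ g) n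

  one : Series
  one zero    = 1#
  one (suc n) = 0#

  ⊛-cong : ∀ {f f′ g g′} → f ≋ f′ → g ≋ g′ → f ⊛ g ≋ f′ ⊛ g′
  ⊛-cong f≋ g≋ zero    = *-cong (f≋ 0) (g≋ 0)
  ⊛-cong f≋ g≋ (suc n) = +-cong (*-cong (f≋ 0) (g≋ (suc n))) (⊛-cong (f≋ ∘ suc) g≋ n)

  -- The defining recursion takes f apart; this mirror image takes g apart, and the two together
  -- give commutativity.
  ⊛-suc : ∀ f g n → (f ⊛ g) (suc n) ≈ f (suc n) * g 0 + (f ⊛ shift g) n
  ⊛-suc f g zero    = +-comm _ _
  ⊛-suc f g (suc n) = begin
    f 0 * g (2 ℕ.+ n) + (shift f ⊛ g) (suc n)
      ≈⟨ +-congˡ (⊛-suc (shift f) g n) ⟩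
    f 0 * g (2 ℕ.+ n) + (f (2 ℕ.+ n) * g 0 + (shift f ⊛ shift g) n)
      ≈⟨ solve 3 (λ x y z → x :+ (y :+ z) := y :+ (x :+ z)) refl _ _ _ ⟩
    f (2 ℕ.+ n) * g 0 + (f 0 * g (2 ℕ.+ n) + (shift f ⊛ shift g) n) ∎

  ⊛-comm : ∀ f g → f ⊛ g ≋ g ⊛ f
  ⊛-comm f g zero    = *-comm _ _
  ⊛-comm f g (suc n) = trans (⊛-suc f g n) (+-cong (*-comm _ _) (⊛-comm f (shift g) n))

  ⊛-distribʳ : ∀ h f g → (λ n → f n + g n) ⊛ h ≋ (λ n → (f ⊛ h) n + (g ⊛ h) n)
  ⊛-distribʳ h f g zero    = distribʳ _ _ _
  ⊛-distribʳ h f g (suc n) = trans (+-congˡ (⊛-distribʳ h (shift f) (shift g) n))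
    (solve 5 (λ x y z u v → (x :+ y) :* z :+ (u :+ v) := (x :* z :+ u) :+ (y :* z :+ v)) refl _ _ _ _ _)

  ⊛-scale : ∀ c f g → (λ n → c * f n) ⊛ g ≋ (λ n → c * (f ⊛ g) n)
  ⊛-scale c f g zero    = *-assoc _ _ _
  ⊛-scale c f g (suc n) = trans (+-congˡ (⊛-scale c (shift f) g n))
    (solve 4 (λ c x y z → c :* x :* y :+ c :* z := c :* (x :* y :+ z)) refl _ _ _ _)

  ⊛-assoc : ∀ f g h → (f ⊛ g) ⊛ h ≋ f ⊛ (g ⊛ h)
  ⊛-assoc f g h zero    = *-assoc _ _ _
  ⊛-assoc f g h (suc n) = begin
    f 0 * g 0 * h (suc n) + (shift (f ⊛ g) ⊛ h) n
      ≈⟨ +-congˡ (⊛-distribʳ h (λ m → f 0 * g (suc m)) (shift f ⊛ g) n) ⟩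
    f 0 * g 0 * h (suc n) + (((λ m → f 0 * g (suc m)) ⊛ h) n + ((shift f ⊛ g) ⊛ h) n)
      ≈⟨ +-congˡ (+-cong (⊛-scale (f 0) (shift g) h n) (⊛-assoc (shift f) g h n)) ⟩
    f 0 * g 0 * h (suc n) + (f 0 * (shift g ⊛ h) n + (shift f ⊛ (g ⊛ h)) n)
      ≈⟨ solve 5 (λ x y z u v → x :* y :* z :+ (x :* u :+ v) := x :* (y :* z :+ u) :+ v) refl _ _ _ _ _ ⟩
    f 0 * (g 0 * h (suc n) + (shift g ⊛ h) n) + (shift f ⊛ (g ⊛ h)) n ∎

  ⊛-zeroˡ : ∀ {f} → f ≋ (λ _ → 0#) → ∀ g n → (f ⊛ g) n ≈ 0#
  ⊛-zeroˡ f≋0 g zero    = trans (*-congʳ (f≋0 0)) (zeroˡ _)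
  ⊛-zeroˡ f≋0 g (suc n) = trans (+-cong (trans (*-congʳ (f≋0 0)) (zeroˡ _)) (⊛-zeroˡ (f≋0 ∘ suc) g n)) (+-identityˡ 0#)

  ⊛-identityˡ : ∀ f → one ⊛ f ≋ f
  ⊛-identityˡ f zero    = *-identityˡ _
  ⊛-identityˡ f (suc n) = trans (+-cong (*-identityˡ _) (⊛-zeroˡ (λ _ → refl) f n)) (+-identityʳ _)

  series : CommutativeRing 0ℓ 0ℓ
  series = record
    { Carrier = Series
    ; _≈_ = _≋_
    ; _+_ = S._+_
    ; _*_ = _⊛_
    ; -_  = S.-_
    ; 0#  = S.0#
    ; 1#  = one
    ; isCommutativeRing = record
      { isRing = record
        { +-isAbelianGroup = S.+-isAbelianGroup
        ; *-cong = ⊛-cong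
        ; *-assoc = ⊛-assoc
        ; *-identity = ⊛-identityˡ , λ f n → trans (⊛-comm f one n) (⊛-identityˡ f n)
        ; distrib = (λ h f g n → trans (⊛-comm h (λ m → f m + g m) n)
                      (trans (⊛-distribʳ h f g n) (+-cong (⊛-comm f h n) (⊛-comm g h n))))
                  , ⊛-distribʳ
        }
      ; *-comm = ⊛-comm
      }
    }

  open Polynomials series using () renaming (Regular to Regularₛ)
  open Polynomials K using (Regular)

  -- The coefficients of g vanish from the lowest up: f 0 g 0 = 0 gives g 0 = 0, and then f
  -- annihilates `shift g` as well.
  regular-leading : ∀ {f} → Regular (f 0) → Regularₛ f
  regular-leading reg g f⊛g≋0 zero    = reg (g 0) (f⊛g≋0 0)
  regular-leading {f} reg g f⊛g≋0 (suc n) = regular-leading {f} reg (shift g) (λ m → begin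
      (f ⊛ shift g) m                           ≈⟨ +-identityˡ _ ⟨
      0# + (f ⊛ shift g) m                      ≈⟨ +-congʳ (trans (*-congˡ (reg (g 0) (f⊛g≋0 0))) (zeroʳ _)) ⟨
      f (suc m) * g 0 + (f ⊛ shift g) m         ≈⟨ ⊛-suc f g m ⟨
      (f ⊛ g) (suc m)                           ≈⟨ f⊛g≋0 (suc m) ⟩
      0#                                        ∎) n

  regular-shift : ∀ {f} → f 0 ≈ 0# → Regularₛ (shift f) → Regularₛ f
  regular-shift {f} f0≈0 reg g f⊛g≋0 = reg g (λ n → begin
    (shift f ⊛ g) n                       ≈⟨ +-identityˡ _ ⟨
    0# + (shift f ⊛ g) n                  ≈⟨ +-congʳ (trans (*-congʳ f0≈0) (zeroˡ _)) ⟨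
    f 0 * g (suc n) + (shift f ⊛ g) n     ≈⟨ f⊛g≋0 (suc n) ⟩
    0#                                    ∎)

-- The ring of integers modulo p

module IntegersModulo (p : ℕ) where

  infix 4 _≈ₚ_
  record _≈ₚ_ (x y : ℤ) : Set where
    constructor differ-by
    field
      quotient : ℤ
      equality : x ≡ y ℤ.+ quotient ℤ.* + p

  commutativeRing : CommutativeRing 0ℓ 0ℓ
  commutativeRing = record
    { Carrier = ℤ
    ; _≈_ = _≈ₚ_
    ; _+_ = ℤ._+_
    ; _*_ = ℤ._*_
    ; -_  = ℤ.-_
    ; 0#  = 0ℤ
    ; 1#  = 1ℤ
    ; isCommutativeRing = record
      { isRing = record
        { +-isAbelianGroup = record
          { isGroup = record
            { isMonoid = record
              { isSemigroup = record
                { isMagma = record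
                  { isEquivalence = record { refl = ≡⇒≈ ≡.refl ; sym = sym′ ; trans = trans′ }
                  ; ∙-cong = +-cong′
                  }
                ; assoc = λ x y z → ≡⇒≈ (ℤₚ.+-assoc x y z)
                }
              ; identity = (λ x → ≡⇒≈ (ℤₚ.+-identityˡ x)) , (λ x → ≡⇒≈ (ℤₚ.+-identityʳ x))
              }
            ; inverse = (λ x → ≡⇒≈ (ℤₚ.+-inverseˡ x)) , (λ x → ≡⇒≈ (ℤₚ.+-inverseʳ x))
            ; ⁻¹-cong = neg-cong
            }
          ; comm = λ x y → ≡⇒≈ (ℤₚ.+-comm x y)
          }
        ; *-cong = *-cong′
        ; *-assoc = λ x y z → ≡⇒≈ (ℤₚ.*-assoc x y z)
        ; *-identity = (λ x → ≡⇒≈ (ℤₚ.*-identityˡ x)) , (λ x → ≡⇒≈ (ℤₚ.*-identityʳ x))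
        ; distrib = (λ x y z → ≡⇒≈ (ℤₚ.*-distribˡ-+ x y z)) , (λ x y z → ≡⇒≈ (ℤₚ.*-distribʳ-+ x y z))
        }
      ; *-comm = λ x y → ≡⇒≈ (ℤₚ.*-comm x y)
      }
    }
    where
    ≡⇒≈ : ∀ {x y} → x ≡ y → x ≈ₚ y
    ≡⇒≈ {x} ≡.refl = differ-by 0ℤ (lemma x (+ p))
      where
      lemma : ∀ x p → x ≡ x ℤ.+ 0ℤ ℤ.* p
      lemma = solve-∀
    sym′ : ∀ {x y} → x ≈ₚ y → y ≈ₚ x
    sym′ {y = y} (differ-by q ≡.refl) = differ-by (ℤ.- q) (lemma y q (+ p))
      where
      lemma : ∀ y q p → y ≡ (y ℤ.+ q ℤ.* p) ℤ.+ (ℤ.- q) ℤ.* p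
      lemma = solve-∀
    trans′ : ∀ {x y z} → x ≈ₚ y → y ≈ₚ z → x ≈ₚ z
    trans′ {z = z} (differ-by q ≡.refl) (differ-by r ≡.refl) = differ-by (q ℤ.+ r) (lemma z q r (+ p))
      where
      lemma : ∀ z q r p → (z ℤ.+ r ℤ.* p) ℤ.+ q ℤ.* p ≡ z ℤ.+ (q ℤ.+ r) ℤ.* p
      lemma = solve-∀
    +-cong′ : ∀ {x x′ y y′} → x ≈ₚ x′ → y ≈ₚ y′ → x ℤ.+ y ≈ₚ x′ ℤ.+ y′
    +-cong′ {x′ = x} {y′ = y} (differ-by q ≡.refl) (differ-by r ≡.refl) = differ-by (q ℤ.+ r) (lemma x y q r (+ p))
      where
      lemma : ∀ x y q r p → (x ℤ.+ q ℤ.* p) ℤ.+ (y ℤ.+ r ℤ.* p) ≡ (x ℤ.+ y) ℤ.+ (q ℤ.+ r) ℤ.* p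
      lemma = solve-∀
    *-cong′ : ∀ {x x′ y y′} → x ≈ₚ x′ → y ≈ₚ y′ → x ℤ.* y ≈ₚ x′ ℤ.* y′
    *-cong′ {x′ = x} {y′ = y} (differ-by q ≡.refl) (differ-by r ≡.refl) =
      differ-by (q ℤ.* y ℤ.+ x ℤ.* r ℤ.+ q ℤ.* r ℤ.* + p) (lemma x y q r (+ p))
      where
      lemma : ∀ x y q r p → (x ℤ.+ q ℤ.* p) ℤ.* (y ℤ.+ r ℤ.* p) ≡
                            x ℤ.* y ℤ.+ (q ℤ.* y ℤ.+ x ℤ.* r ℤ.+ q ℤ.* r ℤ.* p) ℤ.* p
      lemma = solve-∀
    neg-cong : ∀ {x y} → x ≈ₚ y → ℤ.- x ≈ₚ ℤ.- y
    neg-cong {y = y} (differ-by q ≡.refl) = differ-by (ℤ.- q) (lemma y q (+ p))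
      where
      lemma : ∀ y q p → ℤ.- (y ℤ.+ q ℤ.* p) ≡ ℤ.- y ℤ.+ (ℤ.- q) ℤ.* p
      lemma = solve-∀

  open CommutativeRing commutativeRing public hiding (zero; _+_; _*_; -_; 0#; 1#)
  open MonoidMult (CommutativeRing.+-monoid commutativeRing) using () renaming (_×_ to _·_)
  open Polynomials commutativeRing using (Regular)

  ≈0⇒∣ : ∀ {x} → x ≈ 0ℤ → p ∣ ℤ.∣ x ∣
  ≈0⇒∣ (differ-by q eq) = divides ℤ.∣ q ∣ (≡.trans (≡.cong ℤ.∣_∣ (≡.trans eq (ℤₚ.+-identityˡ (q ℤ.* + p)))) (ℤₚ.abs-* q (+ p)))

  ∣⇒≈0 : ∀ x → p ∣ ℤ.∣ x ∣ → x ≈ 0ℤ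
  ∣⇒≈0 x (divides q eq) with ℤₚ.+∣i∣≡i⊎+∣i∣≡-i x
  ... | inj₁ x≡ = differ-by (+ q) (≡.trans (≡.sym x≡) (≡.trans (≡.cong +_ eq)
                    (≡.trans (ℤₚ.pos-* q p) (≡.sym (ℤₚ.+-identityˡ _)))))
  ... | inj₂ -x≡ = differ-by (ℤ.- + q) (≡.trans (≡.sym (ℤₚ.neg-involutive x)) (≡.trans (≡.cong ℤ.-_ (≡.trans (≡.sym -x≡) (≡.trans (≡.cong +_ eq) (ℤₚ.pos-* q p))))
                    (≡.trans (ℤₚ.neg-distribˡ-* (+ q) (+ p)) (≡.sym (ℤₚ.+-identityˡ _)))))

  p≈0 : + p ≈ 0ℤ
  p≈0 = differ-by 1ℤ (≡.sym (≡.trans (ℤₚ.+-identityˡ _) (ℤₚ.*-identityˡ (+ p))))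

  ·≡* : ∀ n x → n · x ≡ + n ℤ.* x
  ·≡* zero    x = ≡.sym (ℤₚ.*-zeroˡ x)
  ·≡* (suc n) x = ≡.trans (≡.cong (λ y → x ℤ.+ y) (·≡* n x)) (≡.sym (ℤₚ.suc-* (+ n) x))

  p·≈0 : ∀ m x → (p ℕ.* m) · x ≈ 0ℤ
  p·≈0 m x = begin
    (p ℕ.* m) · x             ≡⟨ ·≡* (p ℕ.* m) x ⟩
    + (p ℕ.* m) ℤ.* x         ≡⟨ ≡.cong (λ y → y ℤ.* x) (ℤₚ.pos-* p m) ⟩
    + p ℤ.* + m ℤ.* x         ≈⟨ *-congʳ (*-congʳ p≈0) ⟩
    0ℤ ℤ.* + m ℤ.* x          ≡⟨ ≡.cong (λ y → y ℤ.* x) (ℤₚ.*-zeroˡ (+ m)) ⟩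
    0ℤ ℤ.* x                  ≡⟨ ℤₚ.*-zeroˡ x ⟩
    0ℤ                        ∎
    where open SetoidReasoning setoid

  regular-≉0 : Prime p → ∀ {x} → ¬ x ≈ 0ℤ → Regular x
  regular-≉0 pr {x} x≉0 s xs≈0 with euclidsLemma ℤ.∣ x ∣ ℤ.∣ s ∣ pr (≡.subst (p ∣_) (ℤₚ.abs-* x s) (≈0⇒∣ xs≈0))
  ... | inj₁ p∣x = contradiction (∣⇒≈0 x p∣x) x≉0
  ... | inj₂ p∣s = ∣⇒≈0 s p∣s

  residues-distinct : ∀ {a b : Fin p} → a ≢ b → ¬ (+ toℕ a ℤ.- + toℕ b ≈ 0ℤ)
  residues-distinct {a} {b} a≢b eq = a≢b (Finₚ.toℕ-injective (ℤₚ.+-injective (ℤₚ.i-j≡0⇒i≡j (+ toℕ a) (+ toℕ b) diff≡0)))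
    where
    ∣diff∣<p : ℤ.∣ + toℕ a ℤ.- + toℕ b ∣ ℕ.< p
    ∣diff∣<p = ≡.subst (ℕ._< p) (≡.cong ℤ.∣_∣ (≡.sym (ℤₚ.m-n≡m⊖n (toℕ a) (toℕ b))))
      (ℕₚ.≤-<-trans (ℤₚ.∣m⊝n∣≤m⊔n (toℕ a) (toℕ b)) (ℕₚ.⊔-pres-<m (Finₚ.toℕ<n a) (Finₚ.toℕ<n b)))
    diff≡0 : + toℕ a ℤ.- + toℕ b ≡ 0ℤ
    diff≡0 with ℤ.∣ + toℕ a ℤ.- + toℕ b ∣ in abs | ∣diff∣<p | ≈0⇒∣ eq
    ... | zero  | _ | _  = ℤₚ.∣i∣≡0⇒i≡0 abs
    ... | suc _ | x<p | p∣x = contradiction (∣⇒≤ p∣x) (ℕₚ.<⇒≱ x<p)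

module _ {c ℓ} (M : CommutativeMonoid c ℓ) where
  open CommutativeMonoid M renaming (_∙_ to _+_; ∙-congˡ to +-congˡ; ∙-cong to +-cong)
  open MonoidSum M renaming (sum to ∑)

  ∑-↑ : ∀ m {n} (t : Fin (m ℕ.+ n) → Carrier) → ∑ t ≈ ∑ (λ i → t (i ↑ˡ n)) + ∑ (λ j → t (m ↑ʳ j))
  ∑-↑ zero    t = sym (identityˡ _)
  ∑-↑ (suc m) t = trans (+-congˡ (∑-↑ m (t ∘ suc))) (sym (assoc _ _ _))

  ∑-combine : ∀ m {n} (t : Fin (m ℕ.* n) → Carrier) → ∑ t ≈ ∑ (λ i → ∑ (λ j → t (combine {m} i j)))
  ∑-combine zero        t = refl
  ∑-combine (suc m) {n} t = trans (∑-↑ n t) (+-congˡ (∑-combine m (λ i → t (n ↑ʳ i))))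

-- The additive group of digit polynomials, with p^e elements

module DigitPolynomials (p : ℕ) (pr : Prime p) where
  private instance
    p≢0 : NonZero p
    p≢0 = prime⇒nonZero pr

  open IntegersModulo p
  open PowerSeries commutativeRing using (series; regular-leading; regular-shift)
  module R = CommutativeRing series
  module R∑ = MonoidSum R.+-commutativeMonoid
  open MonoidSum (CommutativeRing.+-commutativeMonoid commutativeRing) using (sum-replicate; sum-cong-≋; sum-permute; ∑-distrib-+) renaming (sum to ∑)
  open MonoidMult (CommutativeRing.+-monoid commutativeRing) using () renaming (_×_ to _·_)
  open Polynomials series using (Regular; ¬regular-0)

  1≉0 : ¬ (R.1# R.≈ R.0#)
  1≉0 eq = ℕₚ.<⇒≱ (ℕ.nonTrivial⇒n>1 p ⦃ prime⇒nonTrivial pr ⦄) (∣⇒≤ (≈0⇒∣ (eq 0)))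

  _⊖_ : Fin p → Fin p → Fin p
  a ⊖ b = (toℕ a ℕ.+ (p ℕ.∸ toℕ b)) mod p

  toℕ-⊖ : ∀ a b → + toℕ (a ⊖ b) ≈ + toℕ a ℤ.- + toℕ b
  -- The 1 is the p added in `_⊖_` to stay within the naturals; x / p counts what the reduction
  -- takes off.
  toℕ-⊖ a b = differ-by (1ℤ ℤ.- + (x ℕ./ p)) (begin
    + toℕ (x mod p)                        ≡⟨ ≡.cong +_ (Finₚ.toℕ-fromℕ< (m%n<n x p)) ⟩
    + (x % p)                              ≡⟨ lemma (+ (x % p)) (+ (x ℕ./ p)) (+ p) ⟩
    (+ (x % p) ℤ.+ + (x ℕ./ p) ℤ.* + p) ℤ.+ (ℤ.- + (x ℕ./ p)) ℤ.* + p
                                           ≡⟨ ≡.cong (λ y → y ℤ.+ (ℤ.- + (x ℕ./ p)) ℤ.* + p) x≡ ⟨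
    + x ℤ.+ (ℤ.- + (x ℕ./ p)) ℤ.* + p      ≡⟨ ≡.cong (λ y → y ℤ.+ (ℤ.- + (x ℕ./ p)) ℤ.* + p) y≡ ⟩
    (+ toℕ a ℤ.+ (+ p ℤ.- + toℕ b)) ℤ.+ (ℤ.- + (x ℕ./ p)) ℤ.* + p
                                           ≡⟨ lemma₂ (+ toℕ a) (+ toℕ b) (+ (x ℕ./ p)) (+ p) ⟩
    (+ toℕ a ℤ.- + toℕ b) ℤ.+ (1ℤ ℤ.- + (x ℕ./ p)) ℤ.* + p ∎)
    where
    open ≡.≡-Reasoning
    x = toℕ a ℕ.+ (p ℕ.∸ toℕ b)
    lemma : ∀ r q p → r ≡ (r ℤ.+ q ℤ.* p) ℤ.+ (ℤ.- q) ℤ.* p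
    lemma = solve-∀
    lemma₂ : ∀ a b q p → (a ℤ.+ (p ℤ.- b)) ℤ.+ (ℤ.- q) ℤ.* p ≡ (a ℤ.- b) ℤ.+ (1ℤ ℤ.- q) ℤ.* p
    lemma₂ = solve-∀
    x≡ : + x ≡ + (x % p) ℤ.+ + (x ℕ./ p) ℤ.* + p
    x≡ = ≡.trans (≡.cong +_ (m≡m%n+[m/n]*n x p)) (≡.trans (ℤₚ.pos-+ (x % p) _) (≡.cong (λ y → + (x % p) ℤ.+ y) (ℤₚ.pos-* (x ℕ./ p) p)))
    y≡ : + x ≡ + toℕ a ℤ.+ (+ p ℤ.- + toℕ b)
    y≡ = ≡.trans (ℤₚ.pos-+ (toℕ a) _) (≡.cong (λ y → + toℕ a ℤ.+ y)
      (≡.trans (≡.sym (ℤₚ.⊖-≥ (ℕₚ.<⇒≤ (Finₚ.toℕ<n b)))) (≡.sym (ℤₚ.m-n≡m⊖n p (toℕ b)))))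

  cons : ℤ → R.Carrier → R.Carrier
  cons x f zero    = x
  cons x f (suc n) = f n

  lead : ∀ e → Fin (p ℕ.^ suc e) → Fin p
  lead e x = proj₁ (remQuot {p} (p ℕ.^ e) x)

  rest : ∀ e → Fin (p ℕ.^ suc e) → Fin (p ℕ.^ e)
  rest e x = proj₂ (remQuot {p} (p ℕ.^ e) x)

  -- The base-p digits of x, read as the coefficients of a polynomial of degree less than e.
  ι : ∀ e → Fin (p ℕ.^ e) → R.Carrier
  ι zero    x = R.0#
  ι (suc e) x = cons (+ toℕ (lead e x)) (ι e (rest e x))

  -- Coefficients are subtracted, so there is no borrowing between digits. As x - (x - y) = y, the
  -- map `diff e x` is its own inverse.
  diff : ∀ e → Fin (p ℕ.^ e) → Fin (p ℕ.^ e) → Fin (p ℕ.^ e)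
  diff zero    x y = x
  diff (suc e) x y = combine (lead e x ⊖ lead e y) (diff e (rest e x) (rest e y))

  ι-combine : ∀ e a y → ι (suc e) (combine a y) ≡ cons (+ toℕ a) (ι e y)
  ι-combine e a y = ≡.cong (λ r → cons (+ toℕ (proj₁ r)) (ι e (proj₂ r))) (Finₚ.remQuot-combine a y)

  ι-diff : ∀ e x y → ι e (diff e x y) R.≈ ι e x R.- ι e y
  ι-diff zero    x y n       = refl
  ι-diff (suc e) x y zero    = trans (reflexive (≡.cong (λ f → f 0) (ι-combine e (lead e x ⊖ lead e y) (diff e (rest e x) (rest e y))))) (toℕ-⊖ (lead e x) (lead e y))
  ι-diff (suc e) x y (suc n) = trans (reflexive (≡.cong (λ f → f (suc n)) (ι-combine e (lead e x ⊖ lead e y) (diff e (rest e x) (rest e y))))) (ι-diff e (rest e x) (rest e y) n)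

  -- At the lowest coefficient where the polynomials differ, the difference is nonzero modulo p,
  -- hence regular; the zeros below it are stripped off by `regular-shift`.
  ι-regular : ∀ e {x y} → x ≢ y → Regular (ι e x R.- ι e y)
  ι-regular zero    {zero} {zero} x≢y = contradiction ≡.refl x≢y
  ι-regular (suc e) {x} {y} x≢y with lead e x Fin.≟ lead e y
  ... | no  l≢l = regular-leading (regular-≉0 pr (residues-distinct l≢l))
  ... | yes l≡l = regular-shift (reflexive (ℤₚ.i≡j⇒i-j≡0 (≡.cong (λ a → + toℕ a) l≡l))) (ι-regular e rest≢)
    where
    rest≢ : rest e x ≢ rest e y
    rest≢ eq = x≢y (≡.trans (≡.sym (Finₚ.combine-remQuot {p} (p ℕ.^ e) x))
      (≡.trans (≡.cong₂ combine l≡l eq) (Finₚ.combine-remQuot {p} (p ℕ.^ e) y)))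

  ι-injective : ∀ e {x y} → ι e x R.≈ ι e y → x ≡ y
  ι-injective e {x} {y} eq with x Fin.≟ y
  ... | yes x≡y = x≡y
  ... | no  x≢y = contradiction (ι-regular e x≢y) (¬regular-0 1≉0 (λ n → trans (+-congʳ { ℤ.- ι e y n} (eq n)) (-‿inverseʳ (ι e y n))))

  diff-involutive : ∀ e x y → diff e x (diff e x y) ≡ y
  diff-involutive e x y = ι-injective e (λ n → trans (ι-diff e x (diff e x y) n)
    (trans (+-congˡ {ι e x n} (-‿cong (ι-diff e x y n))) (reflexive (cancel (ι e x n) (ι e y n)))))
    where
    cancel : ∀ x y → x ℤ.- (x ℤ.- y) ≡ y
    cancel = solve-∀

  ∑-coefficient : ∀ {m} (t : Fin m → R.Carrier) n → R∑.sum t n ≡ ∑ (λ i → t i n)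
  ∑-coefficient {zero}  t n = ≡.refl
  ∑-coefficient {suc m} t n = ≡.cong (λ y → t zero n ℤ.+ y) (∑-coefficient (t ∘ suc) n)

  -- Reversal pairs a with p - 1 - a, so twice the sum is p (p - 1), and 2 is regular modulo p > 2.
  ∑-residues : 2 ℕ.< p → ∑ {p} (λ a → + toℕ a) ≈ 0ℤ
  ∑-residues 2<p = regular-≉0 pr {+ 2} (λ 2≈0 → ℕₚ.<⇒≱ 2<p (∣⇒≤ (≈0⇒∣ 2≈0))) S (begin
    + 2 ℤ.* S                                    ≡⟨ double S ⟩
    S ℤ.+ S                                      ≈⟨ +-congˡ {S} (sum-permute {p} {p} (λ a → + toℕ a) Perm.reverse) ⟩
    S ℤ.+ ∑ {p} (λ a → + toℕ (opposite a))       ≈⟨ ∑-distrib-+ {p} (λ a → + toℕ a) (λ a → + toℕ (opposite a)) ⟨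
    ∑ {p} (λ a → + toℕ a ℤ.+ + toℕ (opposite a)) ≈⟨ sum-cong-≋ {p} (λ a → reflexive (opp a)) ⟩
    ∑ {p} (λ a → + (p ℕ.∸ 1))                    ≈⟨ sum-replicate p ⟩
    p · + (p ℕ.∸ 1)                              ≡⟨ ≡.cong (λ m → m · + (p ℕ.∸ 1)) (≡.sym (ℕₚ.*-identityʳ p)) ⟩
    (p ℕ.* 1) · + (p ℕ.∸ 1)                      ≈⟨ p·≈0 1 _ ⟩
    0ℤ                                           ∎)
    where
    open SetoidReasoning setoid
    S = ∑ {p} (λ a → + toℕ a)
    double : ∀ s → + 2 ℤ.* s ≡ s ℤ.+ s
    double = solve-∀
    opp : ∀ {p} (a : Fin p) → + toℕ a ℤ.+ + toℕ (opposite a) ≡ + (p ℕ.∸ 1)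
    opp {suc p} a = ≡.trans (≡.sym (ℤₚ.pos-+ (toℕ a) _)) (≡.cong +_ (≡.trans (≡.cong (toℕ a ℕ.+_) (Finₚ.opposite-prop a))
      (ℕₚ.m+[n∸m]≡n (ℕₚ.≤-pred (Finₚ.toℕ<n a)))))

  -- The digit `lead` is the constant coefficient. The other coefficients do not depend on it, so
  -- its p values give a multiple of p. For k = p^(e + 1) each residue occurs p^e times as constant
  -- coefficient, again a multiple of p unless e = 0; then k = p > 2 and `∑-residues` applies. For k
  -- = 2 the sum would be 1.
  ∑ι≈0 : ∀ e → 2 ℕ.< p ℕ.^ e → R∑.sum (ι e) R.≈ R.0#
  ∑ι≈0 zero    (s≤s ())
  ∑ι≈0 (suc e) 2<k n = begin
    R∑.sum (ι (suc e)) n                                 ≡⟨ ∑-coefficient (ι (suc e)) n ⟩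
    ∑ (λ x → ι (suc e) x n)                              ≈⟨ ∑-combine (CommutativeRing.+-commutativeMonoid commutativeRing) p (λ x → ι (suc e) x n) ⟩
    ∑ {p} (λ a → ∑ (λ y → ι (suc e) (combine a y) n))    ≈⟨ sum-cong-≋ {p} (λ a → sum-cong-≋ (λ y → reflexive (≡.cong (λ f → f n) (ι-combine e a y)))) ⟩
    ∑ {p} (λ a → ∑ (λ y → cons (+ toℕ a) (ι e y) n))     ≈⟨ digit n ⟩
    0ℤ                                                   ∎
    where
    open SetoidReasoning setoid
    digit : ∀ n → ∑ {p} (λ a → ∑ (λ y → cons (+ toℕ a) (ι e y) n)) ≈ 0ℤ
    digit (suc n) = trans (sum-replicate p) (trans (reflexive (≡.cong (_· total) (≡.sym (ℕₚ.*-identityʳ p)))) (p·≈0 1 total))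
      where total = ∑ (λ y → ι e y n)
    digit zero = trans (sum-cong-≋ {p} (λ a → sum-replicate (p ℕ.^ e))) (constant e 2<k)
      where
      constant : ∀ e → 2 ℕ.< p ℕ.^ suc e → ∑ {p} (λ a → (p ℕ.^ e) · + toℕ a) ≈ 0ℤ
      constant zero    2<p = trans (sum-cong-≋ {p} (λ a → reflexive (ℤₚ.+-identityʳ (+ toℕ a)))) (∑-residues (≡.subst (2 ℕ.<_) (ℕₚ.*-identityʳ p) 2<p))
      constant (suc e) _   = trans (sum-cong-≋ {p} (λ a → p·≈0 (p ℕ.^ e) (+ toℕ a)))
        (trans (sum-replicate p) (trans (reflexive (·≡* p 0ℤ)) (reflexive (ℤₚ.*-zeroʳ (+ p)))))

  digitSubgroup : ∀ e → 2 ℕ.< p ℕ.^ e → RegularSubgroup series (p ℕ.^ e)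
  digitSubgroup e 2<k = record
    { ι = ι e
    ; regular = ι-regular e
    ; sub = λ x → permutation (diff e x) (diff e x) (diff-involutive e x) (diff-involutive e x)
    ; ι-sub = ι-diff e
    ; ∑ι≈0 = ∑ι≈0 e 2<k
    }

-- Finite sums

infix 8 [_]

[_] : Bool → ℕ
[ b ] = if b then 1 else 0

sumFin-cong : ∀ {m} {F G : Fin m → ℕ} → (∀ i → F i ≡ G i) → sumFin F ≡ sumFin G
sumFin-cong {zero}  eq = ≡.refl
sumFin-cong {suc m} eq = ≡.cong₂ ℕ._+_ (eq zero) (sumFin-cong (eq ∘ suc))

sumFin-0 : ∀ m → sumFin {m} (λ _ → 0) ≡ 0
sumFin-0 zero    = ≡.refl
sumFin-0 (suc m) = sumFin-0 m

sumFin-1 : ∀ m → sumFin {m} (λ _ → 1) ≡ m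
sumFin-1 zero    = ≡.refl
sumFin-1 (suc m) = ≡.cong suc (sumFin-1 m)

sumFin-+ : ∀ {m} (F G : Fin m → ℕ) → sumFin (λ i → F i ℕ.+ G i) ≡ sumFin F ℕ.+ sumFin G
sumFin-+ {zero}  F G = ≡.refl
sumFin-+ {suc m} F G rewrite sumFin-+ (F ∘ suc) (G ∘ suc) = lemma (F zero) (G zero) _ _
  where
  lemma : ∀ a b c d → a ℕ.+ b ℕ.+ (c ℕ.+ d) ≡ a ℕ.+ c ℕ.+ (b ℕ.+ d)
  lemma = ℕ-solve-∀

sumFin-* : ∀ {m} c (F : Fin m → ℕ) → sumFin (λ i → c ℕ.* F i) ≡ c ℕ.* sumFin F
sumFin-* {zero}  c F = ≡.sym (ℕₚ.*-zeroʳ c)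
sumFin-* {suc m} c F = ≡.trans (≡.cong (c ℕ.* F zero ℕ.+_) (sumFin-* c (F ∘ suc))) (≡.sym (ℕₚ.*-distribˡ-+ c _ _))

sumFin-swap : ∀ {m n} (F : Fin m → Fin n → ℕ) → sumFin (λ i → sumFin (F i)) ≡ sumFin (λ j → sumFin (λ i → F i j))
sumFin-swap {zero}  {n} F = ≡.sym (sumFin-0 n)
sumFin-swap {suc m}     F = ≡.trans (≡.cong (sumFin (F zero) ℕ.+_) (sumFin-swap (F ∘ suc)))
  (≡.sym (sumFin-+ (F zero) (λ j → sumFin (λ i → F (suc i) j))))

count-sum : ∀ {m} (P : Fin m → Bool) → count P ≡ sumFin (λ i → [ P i ])
count-sum {zero}  P = ≡.refl
count-sum {suc m} P = ≡.cong ([ P zero ] ℕ.+_) (count-sum (P ∘ suc))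

sumFin-≟ : ∀ {m} (i : Fin m) → sumFin (λ j → [ ⌊ i Fin.≟ j ⌋ ]) ≡ 1
sumFin-≟ {suc m} zero    = ≡.cong suc (sumFin-0 m)
sumFin-≟ {suc m} (suc i) = ≡.trans (sumFin-cong (λ j → ≡.cong [_] (lemma j))) (sumFin-≟ i)
  where
  lemma : ∀ j → ⌊ suc i Fin.≟ suc j ⌋ ≡ ⌊ i Fin.≟ j ⌋
  lemma j with i Fin.≟ j
  ... | yes _ = ≡.refl
  ... | no  _ = ≡.refl

≤ᵇ-true : ∀ {a b} → a ℕ.≤ b → (a ≤ᵇ b) ≡ true
≤ᵇ-true {a} {b} a≤b with a ≤ᵇ b | ℕₚ.≤⇒≤ᵇ a≤b
... | true | _ = ≡.refl

≤ᵇ-true⁻¹ : ∀ {a b} → (a ≤ᵇ b) ≡ true → a ℕ.≤ b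
≤ᵇ-true⁻¹ {a} {b} eq = ℕₚ.≤ᵇ⇒≤ a b (≡.subst T (≡.sym eq) _)

≤ᵇ-false : ∀ {a b} → b ℕ.< a → (a ≤ᵇ b) ≡ false
≤ᵇ-false {a} {b} b<a with a ≤ᵇ b in eq
... | false = ≡.refl
... | true  = contradiction (≤ᵇ-true⁻¹ eq) (ℕₚ.<⇒≱ b<a)

≤ᵇ-false⁻¹ : ∀ {a b} → (a ≤ᵇ b) ≡ false → b ℕ.< a
≤ᵇ-false⁻¹ {a} {b} eq with a ℕ.≤? b
... | no  a≰b = ℕₚ.≰⇒> a≰b
... | yes a≤b = contradiction (≡.trans (≡.sym (≤ᵇ-true a≤b)) eq) λ ()

_<ᶠ_ : ∀ {n} → Fin n → Fin n → Bool
u <ᶠ v = suc (toℕ u) ≤ᵇ toℕ v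

<ᶠ-weights : ∀ {n} (u v : Fin n) → u ≢ v → [ u <ᶠ v ] ℕ.+ [ v <ᶠ u ] ≡ 1
<ᶠ-weights u v u≢v with ℕₚ.<-cmp (toℕ u) (toℕ v)
... | tri< u<v _ _ rewrite ≤ᵇ-true u<v | ≤ᵇ-false (s≤s (ℕₚ.<⇒≤ u<v)) = ≡.refl
... | tri≈ _ eq _ = contradiction (Finₚ.toℕ-injective eq) u≢v
... | tri> _ _ v<u rewrite ≤ᵇ-true v<u | ≤ᵇ-false (s≤s (ℕₚ.<⇒≤ v<u)) = ≡.refl

-- The two orders of a pair are gathered under u < v. This turns parent-child pairs into tree edges,
-- and darts into edges.
sumFin-unordered : ∀ {n} (h : Fin n → Fin n → ℕ) → (∀ u → h u u ≡ 0) →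
  sumFin (λ u → sumFin (h u)) ≡ sumFin (λ u → sumFin (λ v → [ u <ᶠ v ] ℕ.* (h u v ℕ.+ h v u)))
sumFin-unordered h diag = ≡.sym (begin
  Σ² (λ u v → [ u <ᶠ v ] ℕ.* (h u v ℕ.+ h v u))
    ≡⟨ Σ²-cong (λ u v → ℕₚ.*-distribˡ-+ [ u <ᶠ v ] (h u v) (h v u)) ⟩
  Σ² (λ u v → [ u <ᶠ v ] ℕ.* h u v ℕ.+ [ u <ᶠ v ] ℕ.* h v u)
    ≡⟨ Σ²-+ (λ u v → [ u <ᶠ v ] ℕ.* h u v) (λ u v → [ u <ᶠ v ] ℕ.* h v u) ⟩
  Σ² (λ u v → [ u <ᶠ v ] ℕ.* h u v) ℕ.+ Σ² (λ u v → [ u <ᶠ v ] ℕ.* h v u)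
    ≡⟨ ≡.cong (Σ² (λ u v → [ u <ᶠ v ] ℕ.* h u v) ℕ.+_) (sumFin-swap (λ u v → [ u <ᶠ v ] ℕ.* h v u)) ⟩
  Σ² (λ u v → [ u <ᶠ v ] ℕ.* h u v) ℕ.+ Σ² (λ u v → [ v <ᶠ u ] ℕ.* h u v)
    ≡⟨ Σ²-+ (λ u v → [ u <ᶠ v ] ℕ.* h u v) (λ u v → [ v <ᶠ u ] ℕ.* h u v) ⟨
  Σ² (λ u v → [ u <ᶠ v ] ℕ.* h u v ℕ.+ [ v <ᶠ u ] ℕ.* h u v)
    ≡⟨ Σ²-cong pointwise ⟩
  Σ² h ∎)
  where
  open ≡.≡-Reasoning
  Σ² : ∀ {n} → (Fin n → Fin n → ℕ) → ℕ
  Σ² h = sumFin (λ u → sumFin (h u))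
  Σ²-cong : ∀ {n} {h h′ : Fin n → Fin n → ℕ} → (∀ u v → h u v ≡ h′ u v) → Σ² h ≡ Σ² h′
  Σ²-cong eq = sumFin-cong (λ u → sumFin-cong (eq u))
  Σ²-+ : ∀ {n} (h h′ : Fin n → Fin n → ℕ) → Σ² (λ u v → h u v ℕ.+ h′ u v) ≡ Σ² h ℕ.+ Σ² h′
  Σ²-+ h h′ = ≡.trans (sumFin-cong (λ u → sumFin-+ (h u) (h′ u))) (sumFin-+ (λ u → sumFin (h u)) (λ u → sumFin (h′ u)))
  pointwise : ∀ u v → [ u <ᶠ v ] ℕ.* h u v ℕ.+ [ v <ᶠ u ] ℕ.* h u v ≡ h u v
  pointwise u v with u Fin.≟ v
  ... | yes ≡.refl rewrite diag u | ℕₚ.*-zeroʳ [ u <ᶠ u ] = ≡.refl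
  ... | no u≢v = ≡.trans (≡.sym (ℕₚ.*-distribʳ-+ (h u v) [ u <ᶠ v ] [ v <ᶠ u ]))
    (≡.trans (≡.cong (ℕ._* h u v) (<ᶠ-weights u v u≢v)) (ℕₚ.*-identityˡ (h u v)))

allFin-cong : ∀ {m} {P Q : Fin m → Bool} → (∀ i → P i ≡ Q i) → allFin P ≡ allFin Q
allFin-cong {zero}  eq = ≡.refl
allFin-cong {suc m} eq = ≡.cong₂ _∧_ (eq zero) (allFin-cong (eq ∘ suc))

allFin-false : ∀ {m} (P : Fin m → Bool) → allFin P ≡ false → ∃ λ i → P i ≡ false
allFin-false {suc m} P eq with P zero in P0
... | false = zero , P0
... | true  = let i , Pi = allFin-false (P ∘ suc) eq in suc i , Pi

allFin-intro : ∀ {m} {P : Fin m → Bool} → (∀ i → P i ≡ true) → allFin P ≡ true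
allFin-intro {zero}  all = ≡.refl
allFin-intro {suc m} all = ≡.cong₂ _∧_ (all zero) (allFin-intro (all ∘ suc))

anyFin-elim : ∀ {m} (P : Fin m → Bool) → anyFin P ≡ true → ∃ λ i → P i ≡ true
anyFin-elim {suc m} P eq with P zero in P0
... | true  = zero , P0
... | false = let i , Pi = anyFin-elim (P ∘ suc) eq in suc i , Pi

anyFin-intro : ∀ {m} (P : Fin m → Bool) i → P i ≡ true → anyFin P ≡ true
anyFin-intro P zero    eq rewrite eq = ≡.refl
anyFin-intro P (suc i) eq with P zero
... | true  = ≡.refl
... | false = anyFin-intro (P ∘ suc) i eq

∧-elim : ∀ {a b} → a ∧ b ≡ true → a ≡ true × b ≡ true
∧-elim {true} {true} _ = ≡.refl , ≡.refl

∧-intro : ∀ {a b} → a ≡ true → b ≡ true → a ∧ b ≡ true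
∧-intro ≡.refl ≡.refl = ≡.refl

∨-elim : ∀ {a b} → a ∨ b ≡ true → a ≡ true ⊎ b ≡ true
∨-elim {true}  _  = inj₁ ≡.refl
∨-elim {false} eq = inj₂ eq

∨-introʳ : ∀ a {b} → b ≡ true → a ∨ b ≡ true
∨-introʳ true  _  = ≡.refl
∨-introʳ false eq = eq

≟-elim : ∀ {m} {i j : Fin m} → ⌊ i Fin.≟ j ⌋ ≡ true → i ≡ j
≟-elim {i = i} {j} eq with i Fin.≟ j
... | yes i≡j = i≡j

≟-refl : ∀ {m} (i : Fin m) → ⌊ i Fin.≟ i ⌋ ≡ true
≟-refl i with i Fin.≟ i
... | yes _  = ≡.refl
... | no i≢i = contradiction ≡.refl i≢i

least : (P : ℕ → Bool) → ∀ t → P t ≡ true → ∃ λ d → P d ≡ true × (∀ s → P s ≡ true → d ℕ.≤ s)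
least P zero    eq = 0 , eq , λ _ _ → z≤n
least P (suc t) eq with P 0 in P0
... | true  = 0 , P0 , λ _ _ → z≤n
... | false = let d , Pd , min = least (P ∘ suc) t eq in suc d , Pd , λ
  { zero    Ps → contradiction (≡.trans (≡.sym P0) Ps) λ ()
  ; (suc s) Ps → s≤s (min s Ps) }

-- Spanning forests

module Forests {n : ℕ} (G : Graph n) where

  isRoot : Fin n → Bool
  isRoot v = allFin (λ w → not (reach G n w v) ∨ (toℕ v ≤ᵇ toℕ w))

  reach-trans : ∀ a b {u v w} → reach G a u v ≡ true → reach G b v w ≡ true → reach G (b ℕ.+ a) u w ≡ true
  reach-trans a zero    p q with ≡.refl ← ≟-elim q = p
  reach-trans a (suc b) {u} {v} {w} p q with ∨-elim {reach G b v w} q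
  ... | inj₁ q′ rewrite reach-trans a b p q′ = ≡.refl
  ... | inj₂ q′ with x , eq ← anyFin-elim _ q′ with vx , xw ← ∧-elim eq =
    ∨-introʳ (reach G (b ℕ.+ a) u w) (anyFin-intro (λ y → reach G (b ℕ.+ a) u y ∧ adj G y w) x (∧-intro (reach-trans a b p vx) xw))

  reached : ℕ → Fin n → Bool
  reached t v = anyFin (λ r → isRoot r ∧ reach G t r v)

  abstract
    -- A vertex that is no root is reached from a smaller one, and this descent ends at a root. The
    -- walks are concatenated, so the length may exceed n.
    root-reaches : ∀ v → ∃ λ t → reached t v ≡ true
    root-reaches v = let t , r , root , rv = search v (<-wellFounded (toℕ v)) in
      t , anyFin-intro (λ r → isRoot r ∧ reach G t r v) r (∧-intro root rv)
      where
      search : ∀ v → Acc ℕ._<_ (toℕ v) → ∃₂ λ t r → isRoot r ≡ true × reach G t r v ≡ true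
      search v (acc rec) with isRoot v in root
      ... | true  = 0 , v , root , ≟-refl v
      ... | false with w , eq ← allFin-false (λ w → not (reach G n w v) ∨ (toℕ v ≤ᵇ toℕ w)) root
                  with reach G n w v in wv | eq
      ...   | true | v≤w = let t , r , root , rw = search w (rec (≤ᵇ-false⁻¹ v≤w)) in
        n ℕ.+ t , r , root , reach-trans t n rw wv

  depth : Fin n → ℕ
  depth v = proj₁ (least (λ t → reached t v) (proj₁ (root-reaches v)) (proj₂ (root-reaches v)))

  reached-depth : ∀ v → reached (depth v) v ≡ true
  reached-depth v = proj₁ (proj₂ (least (λ t → reached t v) (proj₁ (root-reaches v)) (proj₂ (root-reaches v))))

  depth-least : ∀ v s → reached s v ≡ true → depth v ℕ.≤ s
  depth-least v = proj₂ (proj₂ (least (λ t → reached t v) (proj₁ (root-reaches v)) (proj₂ (root-reaches v))))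

  IsParent : Fin n → Fin n → Set
  IsParent u v = adj G u v ≡ true × depth u ℕ.< depth v

  -- The last vertex before v on a shortest walk from the set of roots.
  parent-exists : ∀ v → isRoot v ≡ false → ∃ λ u → IsParent u v
  parent-exists v ¬root with depth v in dv | reached-depth v
  ... | d | at-d with r , eq ← anyFin-elim (λ r → isRoot r ∧ reach G d r v) at-d with root , rv ← ∧-elim eq = go d dv rv
    where
    go : ∀ d → depth v ≡ d → reach G d r v ≡ true → ∃ λ u → adj G u v ≡ true × depth u ℕ.< d
    go zero    dv rv with ≡.refl ← ≟-elim rv = contradiction (≡.trans (≡.sym root) ¬root) λ ()
    go (suc d) dv rv with ∨-elim {reach G d r v} rv
    ... | inj₁ rv′ = contradiction (depth-least v d (anyFin-intro (λ r → isRoot r ∧ reach G d r v) r (∧-intro root rv′)))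
                       (ℕₚ.<⇒≱ (ℕₚ.≤-reflexive (≡.sym dv)))
    ... | inj₂ rv′ with u , eq ← anyFin-elim _ rv′ with ru , uv ← ∧-elim eq =
      u , uv , s≤s (depth-least u d (anyFin-intro (λ r → isRoot r ∧ reach G d r u) r (∧-intro root ru)))

  abstract
    -- Roots are given themselves as parent.
    parentOrSelf : ∀ v b → isRoot v ≡ b → Fin n
    parentOrSelf v true  _  = v
    parentOrSelf v false eq = proj₁ (parent-exists v eq)

    parent : Fin n → Fin n
    parent v = parentOrSelf v (isRoot v) ≡.refl

    parent-spec : ∀ v → isRoot v ≡ false → IsParent (parent v) v
    parent-spec v = spec (isRoot v) ≡.refl
      where
      spec : ∀ b (eq : isRoot v ≡ b) → b ≡ false → IsParent (parentOrSelf v b eq) v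
      spec false eq _ = proj₂ (parent-exists v eq)

  -- Here `u` is the parent and `v` the child.
  child : Fin n → Fin n → Bool
  child u v = not (isRoot v) ∧ ⌊ parent v Fin.≟ u ⌋

  child-elim : ∀ {u v} → child u v ≡ true → isRoot v ≡ false × parent v ≡ u × IsParent u v
  child-elim {u} {v} eq with ∧-elim {not (isRoot v)} eq
  ... | nr , pu with ≡.refl ← ≟-elim pu = ¬root , ≡.refl , parent-spec v ¬root
    where
    ¬root = Boolₚ.not-injective nr

  edge treeEdge : Fin n → Fin n → Bool
  edge u v = adj G u v ∧ (u <ᶠ v)
  treeEdge u v = child u v ∨ child v u

  -- Each vertex that is no root has one edge to its parent, and no edge plays this part for both of
  -- its ends, because the depth strictly decreases towards the parent.
  treeEdges-count : sumFin (λ u → sumFin (λ v → [ edge u v ∧ treeEdge u v ])) ℕ.+ numComponents G ≡ n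
  treeEdges-count = begin
    sumFin (λ u → sumFin (λ v → [ edge u v ∧ treeEdge u v ])) ℕ.+ count isRoot
      ≡⟨ ≡.cong₂ ℕ._+_ (sumFin-cong (λ u → sumFin-cong (pointwise u))) (count-sum isRoot) ⟩
    sumFin (λ u → sumFin (λ v → [ u <ᶠ v ] ℕ.* ([ child u v ] ℕ.+ [ child v u ]))) ℕ.+ sumFin (λ v → [ isRoot v ])
      ≡⟨ ≡.cong (ℕ._+ sumFin (λ v → [ isRoot v ])) (sumFin-unordered (λ u v → [ child u v ]) child-irrefl) ⟨
    sumFin (λ u → sumFin (λ v → [ child u v ])) ℕ.+ sumFin (λ v → [ isRoot v ])
      ≡⟨ ≡.cong (ℕ._+ sumFin (λ v → [ isRoot v ])) (≡.trans (sumFin-swap (λ u v → [ child u v ])) (sumFin-cong one-parent)) ⟩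
    sumFin (λ v → [ not (isRoot v) ]) ℕ.+ sumFin (λ v → [ isRoot v ])
      ≡⟨ sumFin-+ (λ v → [ not (isRoot v) ]) (λ v → [ isRoot v ]) ⟨
    sumFin (λ v → [ not (isRoot v) ] ℕ.+ [ isRoot v ])
      ≡⟨ sumFin-cong (λ v → not-weights (isRoot v)) ⟩
    sumFin {n} (λ _ → 1)
      ≡⟨ sumFin-1 n ⟩
    n ∎
    where
    open ≡.≡-Reasoning
    not-weights : ∀ b → [ not b ] ℕ.+ [ b ] ≡ 1
    not-weights true  = ≡.refl
    not-weights false = ≡.refl
    one-parent : ∀ v → sumFin (λ u → [ child u v ]) ≡ [ not (isRoot v) ]
    one-parent v = either (isRoot v) (parent v)
      where
      either : ∀ b x → sumFin (λ u → [ not b ∧ ⌊ x Fin.≟ u ⌋ ]) ≡ [ not b ]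
      either true  x = sumFin-0 n
      either false x = sumFin-≟ x
    child-irrefl : ∀ u → [ child u u ] ≡ 0
    child-irrefl u with child u u in eq
    ... | false = ≡.refl
    ... | true  = contradiction (proj₂ (proj₂ (proj₂ (child-elim {u} {u} eq)))) (ℕₚ.<-irrefl ≡.refl)
    pointwise : ∀ u v → [ edge u v ∧ treeEdge u v ] ≡ [ u <ᶠ v ] ℕ.* ([ child u v ] ℕ.+ [ child v u ])
    pointwise u v with child u v in p | child v u in q
    ... | true | true = contradiction (proj₂ (proj₂ (proj₂ (child-elim {u} {v} p))))
                          (ℕₚ.<-asym (proj₂ (proj₂ (proj₂ (child-elim {v} {u} q)))))
    ... | true | false rewrite proj₁ (proj₂ (proj₂ (child-elim {u} {v} p)))
                             | Boolₚ.∧-identityʳ (u <ᶠ v) = ≡.sym (ℕₚ.*-identityʳ _)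
    ... | false | true rewrite Defs.sym G u v | proj₁ (proj₂ (proj₂ (child-elim {v} {u} q)))
                             | Boolₚ.∧-identityʳ (u <ᶠ v) = ≡.sym (ℕₚ.*-identityʳ _)
    ... | false | false rewrite Boolₚ.∧-zeroʳ (edge u v) = ≡.sym (ℕₚ.*-zeroʳ [ u <ᶠ v ])

  module _ {k : ℕ} (τ : Fin n → Fin n → Permutation′ k) where

    -- In the colours renamed by π, the permutation of a tree arc becomes π v ∘ τ u v ∘ (π u)⁻¹,
    -- which this makes the identity.
    Straightening : (Fin n → Permutation′ k) → Set
    Straightening π = ∀ u v → child u v ≡ true → ∀ a → π v ⟨$⟩ʳ (τ u v ⟨$⟩ʳ a) ≡ π u ⟨$⟩ʳ a

    -- `f` is fuel. By `transport-stable`, every value from `depth v` on gives the composite of the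
    -- inverse permutations along the path from v up to its root.
    transport : ℕ → Fin n → Permutation′ k
    transport zero    v = Perm.id
    transport (suc f) v = if isRoot v then Perm.id else (flip (τ (parent v) v) ∘ₚ transport f (parent v))

    transport-stable : ∀ f f′ v → depth v ℕ.≤ f → depth v ℕ.≤ f′ → transport f v ≡ transport f′ v
    transport-stable zero    zero     v _ _ = ≡.refl
    transport-stable zero    (suc f′) v d≤0 _ with isRoot v in root
    ... | true  = ≡.refl
    ... | false = contradiction (ℕₚ.<-≤-trans (proj₂ (parent-spec v root)) d≤0) λ ()
    transport-stable (suc f) zero     v _ d≤0 with isRoot v in root
    ... | true  = ≡.refl
    ... | false = contradiction (ℕₚ.<-≤-trans (proj₂ (parent-spec v root)) d≤0) λ ()
    transport-stable (suc f) (suc f′) v d≤f d≤f′ with isRoot v in root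
    ... | true  = ≡.refl
    ... | false = ≡.cong (flip (τ (parent v) v) ∘ₚ_) (transport-stable f f′ (parent v)
      (ℕₚ.≤-pred (ℕₚ.<-≤-trans (proj₂ (parent-spec v root)) d≤f))
      (ℕₚ.≤-pred (ℕₚ.<-≤-trans (proj₂ (parent-spec v root)) d≤f′)))

    straighten : ∃ Straightening
    straighten = (λ v → transport (depth v) v) , eq
      where
      eq : Straightening (λ v → transport (depth v) v)
      eq u v ch a with child-elim {u} {v} ch
      ... | ¬root , ≡.refl , (_ , d<) = ≡.trans
        (≡.cong (_⟨$⟩ʳ (τ u v ⟨$⟩ʳ a)) (≡.trans
          (transport-stable (depth v) (suc (depth v)) v ℕₚ.≤-refl (ℕₚ.n≤1+n _))
          (≡.cong (λ b → if b then Perm.id else (flip (τ u v) ∘ₚ transport (depth v) u)) ¬root)))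
        (≡.trans (≡.cong (transport (depth v) u ⟨$⟩ʳ_) (Perm.inverseˡ (τ u v) {a}))
          (≡.cong (_⟨$⟩ʳ a) (transport-stable (depth v) (depth u) u (ℕₚ.<⇒≤ d<) ℕₚ.≤-refl)))

-- Counting by injections

-- A relation takes the place of a map, since a short orbit is matched with a root through an
-- arbitrary position on its walk.
length-≤ : {A B : Set} (R : A → B → Set) → (∀ {x x′ y} → R x y → R x′ y → x ≡ x′) →
  ∀ xs ys → Unique xs → (∀ {x} → x ∈ xs → ∃ λ y → y ∈ ys × R x y) → length xs ℕ.≤ length ys
length-≤ R inj []       ys _             _     = z≤n
length-≤ R inj (x ∷ xs) ys (x∉xs ∷ uniq) image with image (here ≡.refl)
... | y , y∈ys , Rxy with as , bs , ≡.refl ← ∈-∃++ y∈ys = begin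
    suc (length xs)           ≤⟨ s≤s (length-≤ R inj xs (as ++ bs) uniq image′) ⟩
    suc (length (as ++ bs))   ≡⟨ ≡.cong suc (Listₚ.length-++ as) ⟩
    suc (length as ℕ.+ length bs) ≡⟨ ℕₚ.+-suc (length as) (length bs) ⟨
    length as ℕ.+ length (y ∷ bs) ≡⟨ Listₚ.length-++ as ⟨
    length (as ++ y ∷ bs)     ∎
  where
  open ℕₚ.≤-Reasoning
  image′ : ∀ {x′} → x′ ∈ xs → ∃ λ y′ → y′ ∈ as ++ bs × R x′ y′
  image′ x′∈ with image (there x′∈)
  ... | y′ , y′∈ , Rx′y′ with ∈-++⁻ as y′∈
  ...   | inj₁ ∈as = y′ , ∈-++⁺ˡ ∈as , Rx′y′
  ...   | inj₂ (here ≡.refl) = contradiction (inj Rxy Rx′y′) (All.lookup x∉xs x′∈)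
  ...   | inj₂ (there ∈bs) = y′ , ∈-++⁺ʳ as ∈bs , Rx′y′

countL : {A : Set} → (A → Bool) → List A → ℕ
countL P xs = sum (List.map (λ x → [ P x ]) xs)

module _ {A : Set} (P : A → Bool) where

  select : List A → List A
  select = List.filter (λ x → P x Boolₚ.≟ true)

  length-select : ∀ xs → length (select xs) ≡ countL P xs
  length-select [] = ≡.refl
  length-select (x ∷ xs) with P x
  ... | true  = ≡.cong suc (length-select xs)
  ... | false = length-select xs

countL-≤ : {A B : Set} {P : A → Bool} {Q : B → Bool} (R : A → B → Set) → ∀ xs ys → Unique xs →
  (∀ {x x′ y} → P x ≡ true → P x′ ≡ true → R x y → R x′ y → x ≡ x′) →
  (∀ x → P x ≡ true → ∃ λ y → y ∈ ys × Q y ≡ true × R x y) → countL P xs ℕ.≤ countL Q ys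
countL-≤ {P = P} {Q} R xs ys uniq inj image = ≡.subst₂ ℕ._≤_ (length-select P xs) (length-select Q ys)
  (length-≤ (λ x y → P x ≡ true × R x y) (λ { (Px , r) (Px′ , r′) → inj Px Px′ r r′ })
    (select P xs) (select Q ys) (filter⁺ (λ x → P x Boolₚ.≟ true) uniq)
    (λ {x} x∈ → let Px = proj₂ (∈-filter⁻ (λ x → P x Boolₚ.≟ true) {xs = xs} x∈)
                    y , y∈ , Qy , r = image x Px in
      y , ∈-filter⁺ (λ y → Q y Boolₚ.≟ true) y∈ Qy , Px , r))

sum-map-++ : {A : Set} (N : A → ℕ) → ∀ xs ys → sum (List.map N (xs ++ ys)) ≡ sum (List.map N xs) ℕ.+ sum (List.map N ys)
sum-map-++ N []       ys = ≡.refl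
sum-map-++ N (x ∷ xs) ys = ≡.trans (≡.cong (N x ℕ.+_) (sum-map-++ N xs ys)) (≡.sym (ℕₚ.+-assoc (N x) _ _))

sum-cartesianProduct : {A B : Set} (N : A × B → ℕ) → ∀ xs ys →
  sum (List.map N (cartesianProduct xs ys)) ≡ sum (List.map (λ x → sum (List.map (λ y → N (x , y)) ys)) xs)
sum-cartesianProduct N []       ys = ≡.refl
sum-cartesianProduct N (x ∷ xs) ys = ≡.trans (sum-map-++ N (List.map (x ,_) ys) _)
  (≡.cong₂ ℕ._+_ (≡.cong sum (≡.sym (Listₚ.map-∘ ys))) (sum-cartesianProduct N xs ys))

countL-partition : {A : Set} (P Q : A → Bool) → ∀ xs →
  countL P xs ≡ countL (λ x → P x ∧ not (Q x)) xs ℕ.+ countL (λ x → P x ∧ Q x) xs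
countL-partition P Q [] = ≡.refl
countL-partition P Q (x ∷ xs) rewrite countL-partition P Q xs with P x | Q x
... | false | _     = ≡.refl
... | true  | false = ≡.refl
... | true  | true  = ≡.sym (ℕₚ.+-suc _ _)

-- Iteration and the numbering of the face-tracing states

iter-+ : {A : Set} (f : A → A) → ∀ a b x → iter f (a ℕ.+ b) x ≡ iter f a (iter f b x)
iter-+ f zero    b x = ≡.refl
iter-+ f (suc a) b x = ≡.cong f (iter-+ f a b x)

iter-* : {A : Set} (f : A → A) → ∀ {x} q → iter f q x ≡ x → ∀ c → iter f (c ℕ.* q) x ≡ x
iter-* f q eq zero    = ≡.refl
iter-* f q eq (suc c) = ≡.trans (iter-+ f q (c ℕ.* q) _) (≡.trans (≡.cong (iter f q) (iter-* f q eq c)) eq)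

allBelow-elim : ∀ N (P : ℕ → Bool) → allBelow N P ≡ true → ∀ {m} → m ℕ.< N → P m ≡ true
allBelow-elim (suc N) P eq m<N with below , PN ← ∧-elim {allBelow N P} eq with ℕₚ.m<1+n⇒m<n∨m≡n m<N
... | inj₁ m<N′   = allBelow-elim N P below m<N′
... | inj₂ ≡.refl = PN

bit : Bool → Fin 2
bit true  = suc zero
bit false = zero

bit-injective : ∀ {s t} → bit s ≡ bit t → s ≡ t
bit-injective {true}  {true}  _ = ≡.refl
bit-injective {false} {false} _ = ≡.refl

-- This is `key` as a member of a finite set: it serves the pigeonhole principle, decides equality
-- of states and shows `key` injective.
encode : ∀ {n} → State n → Fin (n ℕ.* n ℕ.* 2)
encode (u , v , s) = combine (combine u v) (bit s)

encode-injective : ∀ {n} {x y : State n} → encode x ≡ encode y → x ≡ y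
encode-injective {x = u , v , s} {u′ , v′ , s′} eq
  with uv , st ← Finₚ.combine-injective (combine u v) (bit s) (combine u′ v′) (bit s′) eq
  with ≡.refl , ≡.refl ← Finₚ.combine-injective u v u′ v′ uv
  with ≡.refl ← bit-injective st = ≡.refl

key≡encode : ∀ {n} (x : State n) → key x ≡ toℕ (encode x)
key≡encode {n} (u , v , s) rewrite Finₚ.toℕ-combine (combine u v) (bit s) | Finₚ.toℕ-combine u v =
  ≡.cong₂ ℕ._+_ (≡.trans (ℕₚ.*-comm (toℕ u ℕ.* n ℕ.+ toℕ v) 2) (≡.cong (λ m → 2 ℕ.* (m ℕ.+ toℕ v)) (ℕₚ.*-comm (toℕ u) n))) (toℕ-bit s)
  where
  toℕ-bit : ∀ s → (if s then 1 else 0) ≡ toℕ (bit s)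
  toℕ-bit true  = ≡.refl
  toℕ-bit false = ≡.refl

key-injective : ∀ {n} {x y : State n} → key x ≡ key y → x ≡ y
key-injective {x = x} {y} eq = encode-injective (Finₚ.toℕ-injective
  (≡.trans (≡.sym (key≡encode x)) (≡.trans eq (key≡encode y))))

allStates : ∀ n → List (State n)
allStates n = cartesianProduct (List.allFin n) (cartesianProduct (List.allFin n) (true ∷ false ∷ []))

signs-unique : Unique (true ∷ false ∷ [])
signs-unique = ((λ ()) ∷ []) ∷ ([] ∷ [])

∈-signs : ∀ s → s ∈ true ∷ false ∷ []
∈-signs true  = here ≡.refl
∈-signs false = there (here ≡.refl)

allStates-unique : ∀ n → Unique (allStates n)
allStates-unique n = cartesianProduct⁺ (allFin⁺ n) (cartesianProduct⁺ (allFin⁺ n) signs-unique)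

∈-allStates : ∀ {n} (x : State n) → x ∈ allStates n
∈-allStates (u , v , s) = ∈-cartesianProduct⁺ (∈-allFin u) (∈-cartesianProduct⁺ (∈-allFin v) (∈-signs s))

countL-allStates : ∀ {n} (P : State n → Bool) → countL P (allStates n) ≡
  sumFin (λ u → sumFin (λ v → [ P (u , v , true) ] ℕ.+ ([ P (u , v , false) ] ℕ.+ 0)))
countL-allStates {n} P = ≡.trans (sum-cartesianProduct (λ x → [ P x ]) (List.allFin n) pairs)
  (≡.trans (≡.sym (sumFin-list (λ u → sum (List.map (λ y → [ P (u , y) ]) pairs)))) (sumFin-cong (λ u →
    ≡.trans (sum-cartesianProduct (λ y → [ P (u , y) ]) (List.allFin n) signs)
      (≡.sym (sumFin-list (λ v → sum (List.map (λ s → [ P (u , v , s) ]) signs)))))))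
  where
  signs = true ∷ false ∷ []
  pairs = cartesianProduct (List.allFin n) signs

-- Faces of an embedding of girth at least 5

module Faces {n : ℕ} (G : Graph n) (girth : Girth≥5 G) (S : Scheme G) where

  open Forests G using (isRoot)

  sgn : Bool → Bool → Bool
  sgn l s = if l then s else not s

  sgn-injective : ∀ l {s t} → sgn l s ≡ sgn l t → s ≡ t
  sgn-injective true  eq = eq
  sgn-injective false eq = Boolₚ.not-injective eq

  sgn-involutive : ∀ l s → sgn l (sgn l s) ≡ s
  sgn-involutive true  s = ≡.refl
  sgn-involutive false s = Boolₚ.not-involutive s

  turn : Bool → Fin n → Fin n → Fin n
  turn s v u = if s then ρ S v u else ρ⁻ S v u

  next : State n → State n
  next = step S

  start : State n → Fin n
  start = proj₁

  Dart : State n → Set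
  Dart (u , v , _) = Adj G u v

  adj-sym : ∀ {u v} → Adj G u v → Adj G v u
  adj-sym {u} {v} uv = ≡.trans (Defs.sym G v u) uv

  turn-nbr : ∀ s {v u} → Adj G v u → Adj G v (turn s v u)
  turn-nbr true  = ρ-nbr S _ _
  turn-nbr false = ρ⁻-nbr S _ _

  turn-injective : ∀ s {v u w} → Adj G v u → Adj G v w → turn s v u ≡ turn s v w → u ≡ w
  turn-injective true  {v} vu vw eq = ≡.trans (≡.sym (ρ⁻ρ S v _ vu)) (≡.trans (≡.cong (ρ⁻ S v) eq) (ρ⁻ρ S v _ vw))
  turn-injective false {v} vu vw eq = ≡.trans (≡.sym (ρρ⁻ S v _ vu)) (≡.trans (≡.cong (ρ S v) eq) (ρρ⁻ S v _ vw))

  next-dart : ∀ x → Dart x → Dart (next x)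
  next-dart (u , v , s) uv = turn-nbr (sgn (λs S u v) s) (adj-sym uv)

  iter-dart : ∀ m x → Dart x → Dart (iter next m x)
  iter-dart zero    x dx = dx
  iter-dart (suc m) x dx = next-dart _ (iter-dart m x dx)

  next-injective : ∀ x y → Dart x → Dart y → next x ≡ next y → x ≡ y
  next-injective (u , v , s) (u′ , v′ , s′) uv uv′ eq
    with ≡.refl ← ≡.cong proj₁ eq
    with sgn≡ ← ≡.cong (proj₂ ∘ proj₂) eq
    with ≡.refl ← turn-injective (sgn (λs S u v) s) (adj-sym uv) (adj-sym uv′)
                    (≡.trans (≡.cong (proj₁ ∘ proj₂) eq) (≡.cong (λ t → turn t v u′) (≡.sym sgn≡)))
    with ≡.refl ← sgn-injective (λs S u v) sgn≡ = ≡.refl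

  iter-injective : ∀ m x y → Dart x → Dart y → iter next m x ≡ iter next m y → x ≡ y
  iter-injective zero    x y dx dy eq = eq
  iter-injective (suc m) x y dx dy eq =
    iter-injective m x y dx dy (next-injective _ _ (iter-dart m x dx) (iter-dart m y dy) eq)

  -- Injectivity of `next` on darts cancels the first i steps, so a repetition anywhere is a return
  -- to the start.
  revisit : ∀ x → Dart x → ∀ i {j} → i ℕ.< j → iter next i x ≡ iter next j x →
            ∃ λ d → suc i ℕ.+ d ≡ j × iter next (suc d) x ≡ x
  revisit x dx i i<j eq with d , ≡.refl ← ℕₚ.m≤n⇒∃[o]m+o≡n i<j = d , ≡.refl ,
    ≡.sym (iter-injective i x (iter next (suc d) x) dx (iter-dart (suc d) x dx)
      (≡.trans eq (≡.trans (≡.cong (λ a → iter next a x) (≡.sym (ℕₚ.+-suc i d))) (iter-+ next i (suc d) x))))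

  abstract
    -- Among the first 2 n² + 1 states two coincide, by the pigeonhole principle. The bound on the
    -- period places the whole orbit within the range that `isRep` searches.
    period : ∀ x → Dart x → ∃ λ q → suc q ℕ.≤ 2 ℕ.* n ℕ.* n × iter next (suc q) x ≡ x
    period x dx with i , j , i<j , eq ← Finₚ.pigeonhole (ℕₚ.n<1+n (n ℕ.* n ℕ.* 2)) (λ i → encode (iter next (toℕ i) x))
      with q , i+q≡j , back ← revisit x dx (toℕ i) i<j (encode-injective eq) = q , bound , back
      where
      open ℕₚ.≤-Reasoning
      bound : suc q ℕ.≤ 2 ℕ.* n ℕ.* n
      bound = begin
        suc q              ≤⟨ s≤s (ℕₚ.m≤n+m q (toℕ i)) ⟩
        suc (toℕ i ℕ.+ q)  ≡⟨ i+q≡j ⟩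
        toℕ j              ≤⟨ ℕₚ.≤-pred (Finₚ.toℕ<n j) ⟩
        n ℕ.* n ℕ.* 2      ≡⟨ ℕₚ.*-comm (n ℕ.* n) 2 ⟩
        2 ℕ.* (n ℕ.* n)    ≡⟨ ℕₚ.*-assoc 2 n n ⟨
        2 ℕ.* n ℕ.* n      ∎

  dart : State n → Bool
  dart (u , v , _) = adj G u v

  abstract
    -- `isShort` covers every orbit of at most four states: the lengths 1, 2 and 4 divide 4, and
    -- length 3 would be a triangle.
    isRep isShort : State n → Bool
    isRep x = allBelow (suc (2 ℕ.* n ℕ.* n)) (λ m → key x ≤ᵇ key (iter next m x))
    isShort x = ⌊ encode (iter next 4 x) Fin.≟ encode x ⌋

    isRep-elim : ∀ x → isRep x ≡ true → ∀ {m} → m ℕ.≤ 2 ℕ.* n ℕ.* n → key x ℕ.≤ key (iter next m x)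
    isRep-elim x rep m≤ = ≤ᵇ-true⁻¹ (allBelow-elim (suc (2 ℕ.* n ℕ.* n)) (λ m → key x ≤ᵇ key (iter next m x)) rep (s≤s m≤))

    numOrbits-countL : numOrbits S ≡ countL (λ x → dart x ∧ isRep x) (allStates n)
    numOrbits-countL = ≡.sym (countL-allStates (λ x → dart x ∧ isRep x))

    short-elim : ∀ x → isShort x ≡ true → iter next 4 x ≡ x
    short-elim x eq = encode-injective (≟-elim eq)

    short-intro : ∀ x → iter next 4 x ≡ x → isShort x ≡ true
    short-intro x eq = ≡.trans (≡.cong (λ y → ⌊ encode y Fin.≟ encode x ⌋) eq) (≟-refl (encode x))

  rep-least : ∀ x → Dart x → isRep x ≡ true → ∀ m → key x ℕ.≤ key (iter next m x)
  rep-least x dx rep m with q , q≤ , eq ← period x dx = ≡.subst (λ y → key x ℕ.≤ key y) (≡.sym reduce)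
      (isRep-elim x rep (ℕₚ.≤-trans (ℕₚ.<⇒≤ (m%n<n m (suc q))) q≤))
    where
    reduce : iter next m x ≡ iter next (m % suc q) x
    reduce = ≡.trans (≡.cong (λ a → iter next a x) (m≡m%n+[m/n]*n m (suc q)))
      (≡.trans (iter-+ next (m % suc q) _ x) (≡.cong (iter next (m % suc q)) (iter-* next (suc q) eq (m ℕ./ suc q))))

  return : ∀ x → Dart x → ∀ b → ∃ λ c → iter next c (iter next b x) ≡ x
  -- The b steps already made and b q further ones are b (q + 1) steps, that is b full periods.
  return x dx b with q , _ , eq ← period x dx = b ℕ.* q , ≡.trans (≡.sym (iter-+ next (b ℕ.* q) b x))
    (≡.trans (≡.cong (λ a → iter next a x) (≡.trans (ℕₚ.+-comm (b ℕ.* q) b) (≡.sym (ℕₚ.*-suc b q)))) (iter-* next (suc q) eq b))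

  -- By `return` each of the two is reached from the other, so both keys are minimal in one orbit.
  same-orbit : ∀ x y → Dart x → Dart y → isRep x ≡ true → isRep y ≡ true → ∀ a b → iter next a x ≡ iter next b y → x ≡ y
  same-orbit x y dx dy rx ry a b eq = key-injective (ℕₚ.≤-antisym (below x y dx dy rx a b eq) (below y x dy dx ry b a (≡.sym eq)))
    where
    below : ∀ x y → Dart x → Dart y → isRep x ≡ true → ∀ a b → iter next a x ≡ iter next b y → key x ℕ.≤ key y
    below x y dx dy rx a b eq with c , back ← return y dy b = ≡.subst (λ z → key x ℕ.≤ key z)
      (≡.trans (iter-+ next c a x) (≡.trans (≡.cong (iter next c) eq) back)) (rep-least x dx rx (c ℕ.+ a))

  no-triangle-walk : ∀ x → Dart x → iter next 3 x ≢ x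
  no-triangle-walk x@(u , v , s) dx eq = proj₁ girth _ _ _ dx (iter-dart 1 x dx)
    (≡.subst (Adj G _) (≡.cong proj₁ eq) (iter-dart 2 x dx))

  long-distinct : ∀ x → Dart x → isShort x ≡ false → ∀ d → d ℕ.< 4 → iter next (suc d) x ≢ x
  long-distinct x dx long d d<4 eq = contradiction (≡.trans (≡.sym (short-intro x (four d d<4 eq))) long) λ ()
    where
    four : ∀ d → d ℕ.< 4 → iter next (suc d) x ≡ x → iter next 4 x ≡ x
    four 0 _ eq = iter-* next 1 eq 4
    four 1 _ eq = iter-* next 2 eq 2
    four 2 _ eq = contradiction eq (no-triangle-walk x dx)
    four 3 _ eq = eq
    four (suc (suc (suc (suc _)))) (s≤s (s≤s (s≤s (s≤s ())))) eq

  longRep shortRep : State n → Bool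
  longRep  x = (dart x ∧ isRep x) ∧ not (isShort x)
  shortRep x = (dart x ∧ isRep x) ∧ isShort x

  longRep-elim : ∀ x → longRep x ≡ true → Dart x × isRep x ≡ true × isShort x ≡ false
  longRep-elim x eq with dr , nl ← ∧-elim {dart x ∧ isRep x} eq with d , r ← ∧-elim {dart x} dr = d , r , Boolₚ.not-injective nl

  shortRep-elim : ∀ x → shortRep x ≡ true → Dart x × isRep x ≡ true × iter next 4 x ≡ x
  shortRep-elim x eq with dr , sh ← ∧-elim {dart x ∧ isRep x} eq with d , r ← ∧-elim {dart x} dr = d , r , short-elim x sh

  -- The first five states of a long orbit are distinct, and different orbits share no state. An
  -- edge gives four dart states, from two directions and two signs.
  longReps-count : 5 ℕ.* countL longRep (allStates n) ℕ.≤ 4 ℕ.* numEdges G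
  longReps-count = ≡.subst₂ ℕ._≤_ (sum-cartesianProduct _ (List.allFin 5) (allStates n)) darts-count
    (countL-≤ {P = longRep ∘ proj₂} {Q = dart} (λ { (i , x) y → iter next (toℕ i) x ≡ y })
      (cartesianProduct (List.allFin 5) (allStates n)) (allStates n)
      (cartesianProduct⁺ (allFin⁺ 5) (allStates-unique n)) inj
      (λ { (i , x) lx → iter next (toℕ i) x , ∈-allStates _ , iter-dart (toℕ i) x (proj₁ (longRep-elim x lx)) , ≡.refl }))
    where
    ordered : ∀ x → longRep x ≡ true → (i j : Fin 5) → toℕ i ℕ.< toℕ j → iter next (toℕ i) x ≢ iter next (toℕ j) x
    ordered x lx i j i<j eq with dx , _ , long ← longRep-elim x lx 
      with d , i+d≡j , back ← revisit x dx (toℕ i) i<j eq = long-distinct x dx long d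
        (ℕₚ.≤-<-trans (ℕₚ.m≤n+m d (toℕ i)) (ℕₚ.≤-pred (≡.subst (ℕ._< 5) (≡.sym i+d≡j) (Finₚ.toℕ<n j)))) back
    inj : ∀ {p p′ : Fin 5 × State n} {y} → longRep (proj₂ p) ≡ true → longRep (proj₂ p′) ≡ true →
      iter next (toℕ (proj₁ p)) (proj₂ p) ≡ y → iter next (toℕ (proj₁ p′)) (proj₂ p′) ≡ y → p ≡ p′
    inj {i , x} {j , x′} lx lx′ ≡.refl eq′
      with dx , rx , _ ← longRep-elim x lx with dx′ , rx′ , _ ← longRep-elim x′ lx′
      with ≡.refl ← same-orbit x x′ dx dx′ rx rx′ (toℕ i) (toℕ j) (≡.sym eq′) with ℕₚ.<-cmp (toℕ i) (toℕ j)
    ... | tri≈ _ i≡j _ = ≡.cong (_, x) (Finₚ.toℕ-injective i≡j)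
    ... | tri< i<j _ _ = contradiction (≡.sym eq′) (ordered x lx i j i<j)
    ... | tri> _ _ j<i = contradiction eq′ (ordered x lx j i j<i)
    darts-count : countL dart (allStates n) ≡ 4 ℕ.* numEdges G
    darts-count = begin
      countL dart (allStates n)
        ≡⟨ countL-allStates dart ⟩
      sumFin (λ u → sumFin (λ v → [ adj G u v ] ℕ.+ ([ adj G u v ] ℕ.+ 0)))
        ≡⟨ sumFin-cong (λ u → sumFin-* 2 (λ v → [ adj G u v ])) ⟩
      sumFin (λ u → 2 ℕ.* sumFin (λ v → [ adj G u v ]))
        ≡⟨ sumFin-* 2 (λ u → sumFin (λ v → [ adj G u v ])) ⟩
      2 ℕ.* sumFin (λ u → sumFin (λ v → [ adj G u v ]))
        ≡⟨ ≡.cong (2 ℕ.*_) (sumFin-unordered (λ u v → [ adj G u v ]) (λ u → ≡.cong [_] (irrefl G u))) ⟩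
      2 ℕ.* sumFin (λ u → sumFin (λ v → [ u <ᶠ v ] ℕ.* ([ adj G u v ] ℕ.+ [ adj G v u ])))
        ≡⟨ ≡.cong (2 ℕ.*_) (sumFin-cong (λ u → ≡.trans (sumFin-cong (pointwise u)) (sumFin-* 2 (λ v → [ adj G u v ∧ (u <ᶠ v) ])))) ⟩
      2 ℕ.* sumFin (λ u → 2 ℕ.* sumFin (λ v → [ adj G u v ∧ (u <ᶠ v) ]))
        ≡⟨ ≡.cong (2 ℕ.*_) (sumFin-* 2 (λ u → sumFin (λ v → [ adj G u v ∧ (u <ᶠ v) ]))) ⟩
      2 ℕ.* (2 ℕ.* sumFin (λ u → sumFin (λ v → [ adj G u v ∧ (u <ᶠ v) ])))
        ≡⟨ ℕₚ.*-assoc 2 2 (sumFin (λ u → sumFin (λ v → [ adj G u v ∧ (u <ᶠ v) ]))) ⟨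
      4 ℕ.* sumFin (λ u → sumFin (λ v → [ adj G u v ∧ (u <ᶠ v) ]))
        ≡⟨ ≡.cong (4 ℕ.*_) (sumFin-cong (λ u → ≡.sym (count-sum (λ v → adj G u v ∧ (u <ᶠ v))))) ⟩
      4 ℕ.* numEdges G ∎
      where
      open ≡.≡-Reasoning
      pointwise : ∀ u v → [ u <ᶠ v ] ℕ.* ([ adj G u v ] ℕ.+ [ adj G v u ]) ≡ 2 ℕ.* [ adj G u v ∧ (u <ᶠ v) ]
      pointwise u v rewrite Defs.sym G v u with adj G u v | u <ᶠ v
      ... | true  | true  = ≡.refl
      ... | true  | false = ≡.refl
      ... | false | true  = ≡.refl
      ... | false | false = ≡.refl

  -- A closed face walk of length at most four backtracks, since G has no
  -- cycle of length 3 or 4; its edges are then a whole component, K₂ or P₃.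
  short-nbr′ : ∀ {r a s b} → Adj G r a → iter next 4 (r , a , s) ≡ (r , a , s) → Adj G r b →
              b ≡ a ⊎ iter next 2 (r , a , s) ≡ (r , b , s)
  short-nbr′ {r} {a} {s} {b} ra eq rb = by-cases (decide (c Fin.≟ r))
    where
    x = r , a , s
    s₁ = sgn (λs S r a) s
    c = turn s₁ a r
    s₂ = sgn (λs S a c) s₁
    d = turn s₂ c a
    s₃ = sgn (λs S c d) s₂
    f = turn s₃ d c
    s₄ = sgn (λs S d f) s₃
    f≡r : f ≡ r
    f≡r = ≡.cong proj₁ eq
    turn≡a : turn s r d ≡ a
    turn≡a = ≡.trans (≡.cong₂ (λ t z → turn t z d) (≡.sym (≡.cong (proj₂ ∘ proj₂) eq)) (≡.sym f≡r)) (≡.cong (proj₁ ∘ proj₂) eq)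

    turn-ρ : ∀ s {v y z} → Adj G v y → turn s v y ≡ z → turn s v z ≡ y → ρ S v y ≡ z
    turn-ρ true  vy yz zy = yz
    turn-ρ false {v} {y} {z} vy yz zy = ≡.trans (≡.cong (ρ S v) (≡.sym zy))
      (ρρ⁻ S v z (≡.subst (Adj G v) yz (turn-nbr false vy)))

    -- An exchanged pair is a whole cycle of the rotation at r, so `ρ-cyclic` leaves r no other
    -- neighbours; the two may coincide.
    swap-nbrs : ∀ {y z} → Adj G r y → turn s r y ≡ z → turn s r z ≡ y → ∀ m → iter (ρ S r) m y ≡ y ⊎ iter (ρ S r) m y ≡ z
    swap-nbrs ry yz zy zero = inj₁ ≡.refl
    swap-nbrs {y} {z} ry yz zy (suc m) with swap-nbrs ry yz zy m
    ... | inj₁ eq′ = inj₂ (≡.trans (≡.cong (ρ S r) eq′) (turn-ρ s ry yz zy))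
    ... | inj₂ eq′ = inj₁ (≡.trans (≡.cong (ρ S r) eq′)
      (turn-ρ s (≡.subst (Adj G r) yz (turn-nbr s ry)) zy yz))

    nbrs : ∀ {z} → turn s r a ≡ z → turn s r z ≡ a → b ≡ a ⊎ b ≡ z
    nbrs az za with m , ≡.refl ← ρ-cyclic S r a b ra rb = swap-nbrs ra az za m

    decide : Dec (c ≡ r) → c ≢ r ⊎ c ≡ r
    decide (yes p) = inj₂ p
    decide (no ¬p) = inj₁ ¬p

    by-cases : c ≢ r ⊎ c ≡ r → b ≡ a ⊎ iter next 2 x ≡ (r , b , s)
    -- The walk goes from r to a and back, so the signature of the edge cancels and the sign is s
    -- again; the turn at r then exchanges a and d.
    by-cases (inj₂ c≡r) = case-end (nbrs turn-a turn≡a)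
      where
      s₂≡s : s₂ ≡ s
      s₂≡s = ≡.trans (≡.cong (λ z → sgn (λs S a z) s₁) c≡r)
        (≡.trans (≡.cong (λ l → sgn l s₁) (λs-sym S a r)) (sgn-involutive (λs S r a) s))
      turn-a : turn s r a ≡ d
      turn-a = ≡.cong₂ (λ t z → turn t z a) (≡.sym s₂≡s) (≡.sym c≡r)
      case-end : b ≡ a ⊎ b ≡ d → b ≡ a ⊎ iter next 2 x ≡ (r , b , s)
      case-end (inj₁ b≡a) = inj₁ b≡a
      case-end (inj₂ b≡d) = inj₂ (≡.cong₂ _,_ c≡r (≡.cong₂ _,_ (≡.sym b≡d) s₂≡s))
    by-cases (inj₁ c≢r) with a Fin.≟ d
    -- Here r, a, c, d form a cycle of length 4.
    ... | no a≢d = contradiction (≡.subst (Adj G d) f≡r (iter-dart 3 x ra))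
                     (proj₂ girth r a c d (c≢r ∘ ≡.sym) a≢d ra (iter-dart 1 x ra) (iter-dart 2 x ra))
    -- The turn at r fixes a, which is therefore the only neighbour of r.
    ... | yes a≡d with nbrs {a} fixed fixed
      where
      fixed : turn s r a ≡ a
      fixed = ≡.trans (≡.cong (turn s r) a≡d) turn≡a
    ...   | inj₁ b≡a = inj₁ b≡a
    ...   | inj₂ b≡a = inj₁ b≡a

  abstract
    short-nbr : ∀ {r a s b} → Adj G r a → iter next 4 (r , a , s) ≡ (r , a , s) → Adj G r b →
                b ≡ a ⊎ iter next 2 (r , a , s) ≡ (r , b , s)
    short-nbr = short-nbr′

  Visited : State n → Fin n → Set
  Visited x v = ∃ λ i → start (iter next i x) ≡ v

  short-iter : ∀ x → iter next 4 x ≡ x → ∀ i → iter next 4 (iter next i x) ≡ iter next i x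
  short-iter x short i = ≡.trans (≡.sym (iter-+ next 4 i x)) (≡.trans (≡.cong (λ a → iter next a x) (ℕₚ.+-comm 4 i))
    (≡.trans (iter-+ next i 4 x) (≡.cong (iter next i) short)))

  visited-nbr : ∀ x → Dart x → iter next 4 x ≡ x → ∀ {v w} → Visited x v → Adj G v w → Visited x w
  visited-nbr x dx short (i , ≡.refl) vw with short-nbr (iter-dart i x dx) (short-iter x short i) vw
  ... | inj₁ ≡.refl = suc i , ≡.refl
  -- Two steps later the walk is at r again, about to go to the neighbour in question, so a third
  -- step arrives there.
  ... | inj₂ eq     = suc (suc (suc i)) , ≡.cong (start ∘ next) eq

  visited-reach : ∀ x → Dart x → iter next 4 x ≡ x → ∀ m {v w} → Visited x v → reach G m w v ≡ true → Visited x w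
  visited-reach x dx short zero    vis eq with ≡.refl ← ≟-elim eq = vis
  visited-reach x dx short (suc m) {v} {w} vis eq with ∨-elim {reach G m w v} eq
  ... | inj₁ eq′ = visited-reach x dx short m vis eq′
  ... | inj₂ eq′ with z , wz-zv ← anyFin-elim (λ z → reach G m w z ∧ adj G z v) eq′ with wz , zv ← ∧-elim {reach G m w z} wz-zv =
    visited-reach x dx short m {z} (visited-nbr x dx short vis (adj-sym zv)) wz

  abstract
    -- A walk that closes after four steps visits all neighbours of the vertices it visits, so the
    -- descent to ever smaller vertices of the component stays on the walk until it ends at a root.
    visited-root : ∀ x → Dart x → iter next 4 x ≡ x → ∃ λ r → isRoot r ≡ true × Visited x r
    visited-root x dx short = descend (start x) (0 , ≡.refl) (<-wellFounded _)
      where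
      descend : ∀ v → Visited x v → Acc ℕ._<_ (toℕ v) → ∃ λ r → isRoot r ≡ true × Visited x r
      descend v vis (acc rec) with isRoot v in root
      ... | true  = v , root , vis
      ... | false with w , eq ← allFin-false (λ w → not (reach G n w v) ∨ (toℕ v ≤ᵇ toℕ w)) root
                  with reach G n w v in wv | eq
      ...   | true | v≤w = descend w (visited-reach x dx short n vis wv) (rec (≤ᵇ-false⁻¹ v≤w))

  hasNbr : Fin n → Bool
  hasNbr v = anyFin (λ w → adj G v w)

  nontrivialRoots : ℕ
  nontrivialRoots = sumFin (λ v → [ isRoot v ∧ hasNbr v ])

  -- A short orbit is charged to a root r on it and to the sign s it has there. Another orbit with
  -- the same charge contains a state (r, b, s), which by `short-nbr` lies on the first one; the two
  -- signs give the factor 2.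
  shortReps-count : countL shortRep (allStates n) ℕ.≤ 2 ℕ.* nontrivialRoots
  shortReps-count = ≡.subst (countL shortRep (allStates n) ℕ.≤_) total
    (countL-≤ {P = shortRep} {Q = λ { (r , _) → isRoot r ∧ hasNbr r }}
      (λ { x (r , s) → ∃₂ λ i a → iter next i x ≡ (r , a , s) })
      (allStates n) (cartesianProduct (List.allFin n) (true ∷ false ∷ [])) (allStates-unique n) inj image)
    where
    inj : ∀ {x x′} {y : Fin n × Bool} → shortRep x ≡ true → shortRep x′ ≡ true →
      (∃₂ λ i a → iter next i x ≡ (proj₁ y , a , proj₂ y)) → (∃₂ λ i a → iter next i x′ ≡ (proj₁ y , a , proj₂ y)) → x ≡ x′
    inj {x} {x′} {r , s} sx sx′ (i , a , eq) (j , b , eq′)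
      with dx , rx , short ← shortRep-elim x sx with dx′ , rx′ , _ ← shortRep-elim x′ sx′
      with short-nbr {r} {a} {s} {b} (≡.subst Dart eq (iter-dart i x dx))
             (≡.subst (λ y → iter next 4 y ≡ y) eq (short-iter x short i)) (≡.subst Dart eq′ (iter-dart j x′ dx′))
    ... | inj₁ ≡.refl = same-orbit x x′ dx dx′ rx rx′ i j (≡.trans eq (≡.sym eq′))
    ... | inj₂ eq₂ = same-orbit x x′ dx dx′ rx rx′ (2 ℕ.+ i) j
      (≡.trans (≡.cong (iter next 2) eq) (≡.trans eq₂ (≡.sym eq′)))
    image : ∀ x → shortRep x ≡ true → ∃ λ y → y ∈ cartesianProduct (List.allFin n) (true ∷ false ∷ []) ×
      isRoot (proj₁ y) ∧ hasNbr (proj₁ y) ≡ true × (∃₂ λ i a → iter next i x ≡ (proj₁ y , a , proj₂ y))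
    image x sx with dx , _ , short ← shortRep-elim x sx with r , root , i , ≡.refl ← visited-root x dx short =
      let r , a , s = iter next i x in
      (r , s) , ∈-cartesianProduct⁺ (∈-allFin r) (∈-signs s) ,
      ∧-intro root (anyFin-intro (λ w → adj G r w) a (iter-dart i x dx)) , i , a , ≡.refl
    total : countL (λ { (r , _) → isRoot r ∧ hasNbr r }) (cartesianProduct (List.allFin n) (true ∷ false ∷ [])) ≡ 2 ℕ.* nontrivialRoots
    total = ≡.trans (sum-cartesianProduct _ (List.allFin n) _) (≡.trans (≡.sym (sumFin-list {n} _))
      (sumFin-* 2 (λ v → [ isRoot v ∧ hasNbr v ])))

  reach-isolated : ∀ {v} → hasNbr v ≡ false → ∀ m w → reach G m w v ≡ true → w ≡ v
  reach-isolated iso zero    w eq = ≟-elim eq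
  reach-isolated {v} iso (suc m) w eq with ∨-elim {reach G m w v} eq
  ... | inj₁ eq′ = reach-isolated iso m w eq′
  ... | inj₂ eq′ with z , wz-zv ← anyFin-elim _ eq′ with _ , zv ← ∧-elim {reach G m w z} wz-zv =
    contradiction (≡.trans (≡.sym (anyFin-intro (λ w → adj G v w) z (adj-sym zv))) iso) λ ()

  isolated-root : ∀ v → hasNbr v ≡ false → isRoot v ≡ true
  isolated-root v iso = allFin-intro below
    where
    below : ∀ w → not (reach G n w v) ∨ (toℕ v ≤ᵇ toℕ w) ≡ true
    below w with reach G n w v in eq
    ... | false = ≡.refl
    ... | true with ≡.refl ← reach-isolated iso n w eq = ≤ᵇ-true (ℕₚ.≤-refl {toℕ w})

  components-count : numIsolated G ℕ.+ nontrivialRoots ≡ numComponents G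
  components-count = begin
    numIsolated G ℕ.+ nontrivialRoots
      ≡⟨ ≡.cong (ℕ._+ nontrivialRoots) (count-sum (λ v → not (hasNbr v))) ⟩
    sumFin (λ v → [ not (hasNbr v) ]) ℕ.+ nontrivialRoots
      ≡⟨ sumFin-+ (λ v → [ not (hasNbr v) ]) (λ v → [ isRoot v ∧ hasNbr v ]) ⟨
    sumFin (λ v → [ not (hasNbr v) ] ℕ.+ [ isRoot v ∧ hasNbr v ])
      ≡⟨ sumFin-cong pointwise ⟩
    sumFin (λ v → [ isRoot v ])
      ≡⟨ count-sum isRoot ⟨
    numComponents G ∎
    where
    open ≡.≡-Reasoning
    pointwise : ∀ v → [ not (hasNbr v) ] ℕ.+ [ isRoot v ∧ hasNbr v ] ≡ [ isRoot v ]
    pointwise v with hasNbr v in nbr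
    ... | true  = ≡.cong [_] (Boolₚ.∧-identityʳ (isRoot v))
    ... | false rewrite isolated-root v nbr = ≡.refl

  -- Take Euler's inequality five times. Five times the number of orbits is at most 4 m for the long
  -- ones and 10 per component with edges for the short ones; an isolated vertex also contributes
  -- 10. The components thus use up 10 c of the 20 c on the left.
  euler-bound : ∀ {g} → EulerGenus≤ S g → 3 ℕ.* numEdges G ℕ.+ 5 ℕ.* numComponents G ℕ.≤ 5 ℕ.* n ℕ.+ 5 ℕ.* g
  euler-bound {g} euler = ℕₚ.*-cancelˡ-≤ 2 (ℕₚ.+-cancelˡ-≤ (4 ℕ.* e ℕ.+ 10 ℕ.* c) _ _ (begin
    4 ℕ.* e ℕ.+ 10 ℕ.* c ℕ.+ 2 ℕ.* (3 ℕ.* e ℕ.+ 5 ℕ.* c)   ≡⟨ lemma₁ e c ⟩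
    5 ℕ.* (2 ℕ.* (2 ℕ.* c ℕ.+ e))                          ≤⟨ ℕₚ.*-monoʳ-≤ 5 euler ⟩
    5 ℕ.* (2 ℕ.* g ℕ.+ 2 ℕ.* n ℕ.+ numOrbits S ℕ.+ 2 ℕ.* iso)
      ≡⟨ ≡.cong (λ o → 5 ℕ.* (2 ℕ.* g ℕ.+ 2 ℕ.* n ℕ.+ o ℕ.+ 2 ℕ.* iso)) (≡.trans numOrbits-countL
           (countL-partition (λ x → dart x ∧ isRep x) isShort (allStates n))) ⟩
    5 ℕ.* (2 ℕ.* g ℕ.+ 2 ℕ.* n ℕ.+ (L ℕ.+ s) ℕ.+ 2 ℕ.* iso)
      ≡⟨ lemma₂ g n L s iso ⟩
    5 ℕ.* L ℕ.+ (5 ℕ.* s ℕ.+ (10 ℕ.* iso ℕ.+ 10 ℕ.* (n ℕ.+ g)))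
      ≤⟨ ℕₚ.+-mono-≤ longReps-count (ℕₚ.+-monoˡ-≤ _ (ℕₚ.*-monoʳ-≤ 5 shortReps-count)) ⟩
    4 ℕ.* e ℕ.+ (5 ℕ.* (2 ℕ.* r) ℕ.+ (10 ℕ.* iso ℕ.+ 10 ℕ.* (n ℕ.+ g)))
      ≡⟨ lemma₃ e r iso n g ⟩
    4 ℕ.* e ℕ.+ 10 ℕ.* (iso ℕ.+ r) ℕ.+ 2 ℕ.* (5 ℕ.* n ℕ.+ 5 ℕ.* g)
      ≡⟨ ≡.cong (λ c → 4 ℕ.* e ℕ.+ 10 ℕ.* c ℕ.+ 2 ℕ.* (5 ℕ.* n ℕ.+ 5 ℕ.* g)) components-count ⟩
    4 ℕ.* e ℕ.+ 10 ℕ.* c ℕ.+ 2 ℕ.* (5 ℕ.* n ℕ.+ 5 ℕ.* g) ∎))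
    where
    open ℕₚ.≤-Reasoning
    e = numEdges G
    c = numComponents G
    L = countL longRep (allStates n)
    s = countL shortRep (allStates n)
    iso = numIsolated G
    r = nontrivialRoots
    lemma₁ : ∀ e c → 4 ℕ.* e ℕ.+ 10 ℕ.* c ℕ.+ 2 ℕ.* (3 ℕ.* e ℕ.+ 5 ℕ.* c) ≡ 5 ℕ.* (2 ℕ.* (2 ℕ.* c ℕ.+ e))
    lemma₁ = ℕ-solve-∀
    lemma₂ : ∀ g n L s i → 5 ℕ.* (2 ℕ.* g ℕ.+ 2 ℕ.* n ℕ.+ (L ℕ.+ s) ℕ.+ 2 ℕ.* i) ≡
                           5 ℕ.* L ℕ.+ (5 ℕ.* s ℕ.+ (10 ℕ.* i ℕ.+ 10 ℕ.* (n ℕ.+ g)))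
    lemma₂ = ℕ-solve-∀
    lemma₃ : ∀ e r i n g → 4 ℕ.* e ℕ.+ (5 ℕ.* (2 ℕ.* r) ℕ.+ (10 ℕ.* i ℕ.+ 10 ℕ.* (n ℕ.+ g))) ≡
                           4 ℕ.* e ℕ.+ 10 ℕ.* (i ℕ.+ r) ℕ.+ 2 ℕ.* (5 ℕ.* n ℕ.+ 5 ℕ.* g)
    lemma₃ = ℕ-solve-∀

-- Colourings

open import Data.Nat using (_+_; _*_; _∸_; _^_; _≤_; _<_)

countVec-cong : ∀ n {k} {P Q : Vec (Fin k) n → Bool} → (∀ v → P v ≡ Q v) → countVec n P ≡ countVec n Q
countVec-cong zero    P≗Q rewrite P≗Q [] = ≡.refl
countVec-cong (suc n) P≗Q = sumFin-cong (λ a → countVec-cong n (λ v → P≗Q (a ∷ v)))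

toFun : ∀ {n k} → Vec (Fin k) n → Fin n → Fin k
toFun []      = λ ()
toFun (a ∷ v) = a Functional.∷ toFun v

lookup≗toFun : ∀ {n k} (v : Vec (Fin k) n) i → toFun v i ≡ lookup v i
lookup≗toFun (a ∷ v) zero    = ≡.refl
lookup≗toFun (a ∷ v) (suc i) = lookup≗toFun v i

countFun-toFun : ∀ n k (P : (Fin n → Fin k) → Bool) → countFun n k P ≡ countVec n (P ∘ toFun)
countFun-toFun zero    k P = ≡.refl
countFun-toFun (suc n) k P = sumFin-cong (λ a → countFun-toFun n k (λ f → P (a Functional.∷ f)))

≟-cong : ∀ {m n} {a b : Fin m} {c d : Fin n} → (a ≡ b → c ≡ d) → (c ≡ d → a ≡ b) → ⌊ a Fin.≟ b ⌋ ≡ ⌊ c Fin.≟ d ⌋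
≟-cong {a = a} {b} {c} {d} to from with a Fin.≟ b | c Fin.≟ d
... | yes _ | yes _ = ≡.refl
... | no  _ | no  _ = ≡.refl
... | yes p | no ¬q = contradiction (to p) ¬q
... | no ¬p | yes q = contradiction (from q) ¬p

module Colourings {n k : ℕ} (G : Graph n) (L : Labeling G k) where

  open Forests G

  arcOK-cong : ∀ {κ κ′ : Fin n → Fin k} → (∀ i → κ i ≡ κ′ i) → ∀ u v → arcOK L κ u v ≡ arcOK L κ′ u v
  arcOK-cong eq u v rewrite eq u | eq v = ≡.refl

  isProper-cong : ∀ {κ κ′ : Fin n → Fin k} → (∀ i → κ i ≡ κ′ i) → isProper L κ ≡ isProper L κ′
  isProper-cong eq = allFin-cong (λ u → allFin-cong (λ v → ≡.cong (not (edge u v) ∨_) (arcOK-cong eq u v)))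

  numProper-countVec : numProper L ≡ countVec n (isProper L ∘ lookup)
  numProper-countVec = ≡.trans (countFun-toFun n k (isProper L))
    (countVec-cong n (λ v → isProper-cong (lookup≗toFun v)))

  -- The permutation that a colouring must avoid along u → v, for u < v.
  forbidden : Fin n → Fin n → Permutation′ k
  forbidden u v = if orient L u v then σ L u v else flip (σ L u v)

  arcOK-forbidden : ∀ κ u v → arcOK L κ u v ≡ not ⌊ (forbidden u v ⟨$⟩ʳ κ u) Fin.≟ κ v ⌋
  arcOK-forbidden κ u v with orient L u v
  ... | true  = ≡.refl
  ... | false = ≡.cong not (≟-cong
    (λ eq → ≡.trans (≡.cong (σ L u v ⟨$⟩ˡ_) (≡.sym eq)) (Perm.inverseˡ (σ L u v)))
    (λ eq → ≡.trans (≡.cong (σ L u v ⟨$⟩ʳ_) (≡.sym eq)) (Perm.inverseʳ (σ L u v))))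

  -- Tree arcs run from parent to child, whichever end is smaller, so the permutation to be avoided
  -- is needed in both directions.
  τ : Fin n → Fin n → Permutation′ k
  τ u v = if u <ᶠ v then forbidden u v else flip (forbidden v u)

  π : Fin n → Permutation′ k
  π = proj₁ (straighten τ)

  θ : Fin n → Fin n → Permutation′ k
  θ u v = flip (π u) ∘ₚ (forbidden u v ∘ₚ π v)

  arcOK-renamed : ∀ κ u v → arcOK L κ u v ≡ not ⌊ (θ u v ⟨$⟩ʳ (π u ⟨$⟩ʳ κ u)) Fin.≟ (π v ⟨$⟩ʳ κ v) ⌋
  arcOK-renamed κ u v = ≡.trans (arcOK-forbidden κ u v) (≡.cong not (≟-cong
      (λ eq → ≡.trans θπ (≡.cong (π v ⟨$⟩ʳ_) eq))
      (λ eq → ≡.trans (≡.sym (Perm.inverseˡ (π v))) (≡.trans (≡.cong (π v ⟨$⟩ˡ_) (≡.trans (≡.sym θπ) eq)) (Perm.inverseˡ (π v))))))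
    where
    θπ : θ u v ⟨$⟩ʳ (π u ⟨$⟩ʳ κ u) ≡ π v ⟨$⟩ʳ (forbidden u v ⟨$⟩ʳ κ u)
    θπ = ≡.cong (λ a → π v ⟨$⟩ʳ (forbidden u v ⟨$⟩ʳ a)) (Perm.inverseˡ (π u))

  -- If u is the parent, this is the straightening identity π v ∘ τ u v = π u. If v is, then `τ v u`
  -- is the inverse of `forbidden u v`, and the identity for the arc from v to u is read backwards.
  θ-tree : ∀ u v → edge u v ≡ true → treeEdge u v ≡ true → ∀ a → θ u v ⟨$⟩ʳ a ≡ a
  θ-tree u v uv tree a with _ , u<v ← ∧-elim {adj G u v} uv with ∨-elim {child u v} tree
  ... | inj₁ ch = ≡.trans (≡.cong (λ ρ → π v ⟨$⟩ʳ (ρ ⟨$⟩ʳ x)) (≡.sym τ≡))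
      (≡.trans (proj₂ (straighten τ) u v ch x) (Perm.inverseʳ (π u)))
    where
    x = π u ⟨$⟩ˡ a
    τ≡ : τ u v ≡ forbidden u v
    τ≡ = ≡.cong (λ b → if b then forbidden u v else flip (forbidden v u)) u<v
  ... | inj₂ ch = ≡.trans (≡.sym (proj₂ (straighten τ) v u ch (forbidden u v ⟨$⟩ʳ x)))
      (≡.trans (≡.cong (λ ρ → π u ⟨$⟩ʳ (ρ ⟨$⟩ʳ (forbidden u v ⟨$⟩ʳ x))) τ≡)
        (≡.trans (≡.cong (π u ⟨$⟩ʳ_) (Perm.inverseˡ (forbidden u v))) (Perm.inverseʳ (π u))))
    where
    x = π u ⟨$⟩ˡ a
    τ≡ : τ v u ≡ flip (forbidden u v)
    τ≡ = ≡.cong (λ b → if b then forbidden v u else flip (forbidden u v)) (≤ᵇ-false {suc (toℕ v)} {toℕ u} (s≤s (ℕₚ.<⇒≤ (≤ᵇ-true⁻¹ {suc (toℕ u)} {toℕ v} u<v))))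

  module _ (J : ℕ) where

    edgeDegree : Fin n → Fin n → ℕ
    edgeDegree u v = if edge u v then (if treeEdge u v then 1 else suc J) else 0

    totalDegree : ℕ
    totalDegree = sumFin (λ u → sumFin (edgeDegree u))

    -- A tree edge has degree 1 in place of J + 1 = k - 2; adding the missing J to it gives all
    -- edges the same degree and avoids subtraction.
    totalDegree-eq : totalDegree + J * sumFin (λ u → sumFin (λ v → [ edge u v ∧ treeEdge u v ])) ≡ suc J * numEdges G
    totalDegree-eq = begin
      totalDegree + J * sumFin (λ u → sumFin (t u))
        ≡⟨ ≡.cong (λ m → totalDegree + m) (sumFin-* J (λ u → sumFin (t u))) ⟨
      totalDegree + sumFin (λ u → J * sumFin (t u))
        ≡⟨ sumFin-+ (λ u → sumFin (edgeDegree u)) (λ u → J * sumFin (t u)) ⟨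
      sumFin (λ u → sumFin (edgeDegree u) + J * sumFin (t u))
        ≡⟨ sumFin-cong row ⟩
      sumFin (λ u → suc J * count (edge u))
        ≡⟨ sumFin-* (suc J) (λ u → count (edge u)) ⟩
      suc J * numEdges G ∎
      where
      open ≡.≡-Reasoning
      t : Fin n → Fin n → ℕ
      t u v = [ edge u v ∧ treeEdge u v ]
      pointwise : ∀ u v → edgeDegree u v + J * t u v ≡ suc J * [ edge u v ]
      pointwise u v with edge u v | treeEdge u v
      ... | false | _     = ≡.refl
      ... | true  | true  = ≡.refl
      ... | true  | false = ≡.trans (≡.cong (λ m → suc J + m) (ℕₚ.*-zeroʳ J)) (≡.trans (ℕₚ.+-identityʳ (suc J)) (≡.sym (ℕₚ.*-identityʳ (suc J))))
      row : ∀ u → sumFin (edgeDegree u) + J * sumFin (t u) ≡ suc J * count (edge u)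
      row u = begin
        sumFin (edgeDegree u) + J * sumFin (t u)             ≡⟨ ≡.cong (λ m → sumFin (edgeDegree u) + m) (sumFin-* J (t u)) ⟨
        sumFin (edgeDegree u) + sumFin (λ v → J * t u v)     ≡⟨ sumFin-+ (edgeDegree u) (λ v → J * t u v) ⟨
        sumFin (λ v → edgeDegree u v + J * t u v)            ≡⟨ sumFin-cong (pointwise u) ⟩
        sumFin (λ v → suc J * [ edge u v ])                  ≡⟨ sumFin-* (suc J) (λ v → [ edge u v ]) ⟩
        suc J * sumFin (λ v → [ edge u v ])                  ≡⟨ ≡.cong (suc J *_) (count-sum (edge u)) ⟨
        suc J * count (edge u)                               ∎

module _ {n J : ℕ} (G : Graph n) (L : Labeling G (suc (suc (suc J)))) (R : CommutativeRing 0ℓ 0ℓ)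
         (1≉0 : ¬ (CommutativeRing._≈_ R (CommutativeRing.1# R) (CommutativeRing.0# R)))
         (A : RegularSubgroup R (suc (suc (suc J)))) where

  open Forests G
  open Colourings G L
  open AlonFüredi R
  open Indicators R
  open Edges 1≉0 A

  edge-indicator : ∀ u v → Indicator (renamed π) (edgeDegree J u v) (λ κ → not (edge u v) ∨ arcOK L (lookup κ) u v)
  edge-indicator u v with edge u v in uv | treeEdge u v in tree
  ... | false | _     = indicator-true
  ... | true  | true  = indicator-cong (λ κ → ≡.sym (arcOK-renamed (lookup κ) u v)) (straight-edge π {θ u v} (θ-tree u v uv tree) u v)
  ... | true  | false = indicator-cong (λ κ → ≡.sym (arcOK-renamed (lookup κ) u v)) (twisted-edge π (θ u v) u v)

  colourings-bound : (∃ λ κ → isProper L κ ≡ true) →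
    suc (suc (suc J)) ^ (n * suc (suc J)) ≤ numProper L ^ suc (suc J) * suc (suc (suc J)) ^ totalDegree J
  colourings-bound (κ , proper) = ≡.subst (λ N → suc (suc (suc J)) ^ (n * suc (suc J)) ≤ N ^ suc (suc J) * suc (suc (suc J)) ^ totalDegree J)
    (≡.sym numProper-countVec)
    (alonFüredi 1≉0 (regular-renamed π) (isProper L ∘ lookup)
      (indicator-allFin (λ u → indicator-allFin (edge-indicator u)))
      (tabulate κ , ≡.trans (isProper-cong (lookup∘tabulate κ)) proper))

-- Arithmetic of the exponents and conclusion

degree-bound : ∀ n g J D F E c → 5 * g ≤ n → D + J * F ≡ suc J * E → F + c ≡ n → 3 * E + 5 * c ≤ 5 * n + 5 * g →
  (n ∸ 5 * g) * suc J + D * 3 ≤ n * suc (suc J) * 3 + 3 * J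
degree-bound n g J D F E c 5g≤n deg tree euler = ℕₚ.+-cancelʳ-≤ X _ _ (begin
  (a * suc J + D * 3) + X                             ≡⟨ lemma₁ a g J D F c ⟩
  (a + 5 * g) * suc J + (3 * (D + J * F) + suc J * (5 * c)) + 3 * (J * c)
    ≡⟨ ≡.cong₂ (λ x y → x * suc J + (3 * y + suc J * (5 * c)) + 3 * (J * c)) (ℕₚ.m∸n+n≡m 5g≤n) deg ⟩
  n * suc J + (3 * (suc J * E) + suc J * (5 * c)) + 3 * (J * c)
    ≡⟨ lemma₂ n J E c ⟩
  n * suc J + suc J * (3 * E + 5 * c) + 3 * (J * c)   ≤⟨ ℕₚ.+-monoˡ-≤ (3 * (J * c)) (ℕₚ.+-monoʳ-≤ (n * suc J) (ℕₚ.*-monoʳ-≤ (suc J) euler)) ⟩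
  -- 3 J is the term 3 (k - 3) of the conclusion, and 2 J c + 5 c = (2 (k - 2) + 3) c is what the
  -- terms in c leave over.
  n * suc J + suc J * (5 * n + 5 * g) + 3 * (J * c)   ≤⟨ ℕₚ.m≤m+n _ (3 * J + 2 * (J * c) + 5 * c) ⟩
  n * suc J + suc J * (5 * n + 5 * g) + 3 * (J * c) + (3 * J + 2 * (J * c) + 5 * c)
    ≡⟨ lemma₃ n g J c ⟩
  (n * suc (suc J) * 3 + 3 * J) + (3 * (J * n) + suc J * (5 * c) + 5 * g * suc J)
    ≡⟨ ≡.cong (λ m → (n * suc (suc J) * 3 + 3 * J) + (3 * (J * m) + suc J * (5 * c) + 5 * g * suc J)) tree ⟨
  (n * suc (suc J) * 3 + 3 * J) + X                   ∎)
  where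
  open ℕₚ.≤-Reasoning
  a = n ∸ 5 * g
  -- Added on both sides so that `a + 5 * g`, `D + J * F` and `F + c` appear and the hypotheses
  -- apply without subtraction.
  X = 3 * (J * (F + c)) + suc J * (5 * c) + 5 * g * suc J
  lemma₁ : ∀ a g J D F c → (a * suc J + D * 3) + (3 * (J * (F + c)) + suc J * (5 * c) + 5 * g * suc J) ≡
                           (a + 5 * g) * suc J + (3 * (D + J * F) + suc J * (5 * c)) + 3 * (J * c)
  lemma₁ = ℕ-solve-∀
  lemma₂ : ∀ n J E c → n * suc J + (3 * (suc J * E) + suc J * (5 * c)) + 3 * (J * c) ≡
                       n * suc J + suc J * (3 * E + 5 * c) + 3 * (J * c)
  lemma₂ = ℕ-solve-∀
  lemma₃ : ∀ n g J c → n * suc J + suc J * (5 * n + 5 * g) + 3 * (J * c) + (3 * J + 2 * (J * c) + 5 * c) ≡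
                       (n * suc (suc J) * 3 + 3 * J) + (3 * (J * n) + suc J * (5 * c) + 5 * g * suc J)
  lemma₃ = ℕ-solve-∀

-- The third power clears the 3 in the bound on `D`; the common factor k^(3 D) then cancels.
cube-and-cancel : ∀ k .{{_ : NonZero k}} N K M D a J → k ^ M ≤ N ^ K * k ^ D → a + D * 3 ≤ M * 3 + J →
  k ^ a ≤ N ^ (3 * K) * k ^ J
cube-and-cancel k N K M D a J bound exps = ℕₚ.*-cancelʳ-≤ _ _ (k ^ (D * 3)) {{ℕₚ.m^n≢0 k (D * 3)}} (begin
  k ^ a * k ^ (D * 3)                       ≡⟨ ℕₚ.^-distribˡ-+-* k a (D * 3) ⟨
  k ^ (a + D * 3)                           ≤⟨ ℕₚ.^-monoʳ-≤ k exps ⟩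
  k ^ (M * 3 + J)                           ≡⟨ ℕₚ.^-distribˡ-+-* k (M * 3) J ⟩
  k ^ (M * 3) * k ^ J                       ≡⟨ ≡.cong (_* k ^ J) (ℕₚ.^-*-assoc k M 3) ⟨
  (k ^ M) ^ 3 * k ^ J                       ≤⟨ ℕₚ.*-monoˡ-≤ (k ^ J) (ℕₚ.^-monoˡ-≤ 3 bound) ⟩
  (N ^ K * k ^ D) ^ 3 * k ^ J               ≡⟨ ≡.cong (_* k ^ J) (^-distribʳ-* (N ^ K) (k ^ D) 3) ⟩
  ((N ^ K) ^ 3 * (k ^ D) ^ 3) * k ^ J       ≡⟨ ≡.cong₂ (λ x y → (x * y) * k ^ J)
                                                 (≡.trans (ℕₚ.^-*-assoc N K 3) (≡.cong (N ^_) (ℕₚ.*-comm K 3)))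
                                                 (ℕₚ.^-*-assoc k D 3) ⟩
  (N ^ (3 * K) * k ^ (D * 3)) * k ^ J       ≡⟨ ℕ*.xy∙z≈xz∙y (N ^ (3 * K)) (k ^ (D * 3)) (k ^ J) ⟩
  (N ^ (3 * K) * k ^ J) * k ^ (D * 3)       ∎)
  where open ℕₚ.≤-Reasoning

-- The inequality is raised to the power 3 (k - 1), and k^(3 (k - 3)) is brought to the other side
-- to keep the exponents natural. Since it holds for every labeling, it holds for one attaining the
-- minimum.
theorem5p1 : (n g k : ℕ) (G : Graph n) → Girth≥5 G → EmbedsInEulerGenus G g →
  DPColorable G k → IsPrimePower k → 2 < k → 5 * g ≤ n →
  (L : Labeling G k) →
    k ^ ((n ∸ 5 * g) * (k ∸ 2)) ≤ numProper L ^ (3 * (k ∸ 1)) * k ^ (3 * (k ∸ 3))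
theorem5p1 n g (suc zero) G _ _ _ _ (s≤s ())
theorem5p1 n g (suc (suc zero)) G _ _ _ _ (s≤s (s≤s ()))
theorem5p1 n g k@(suc (suc (suc J))) G girth (S , euler) colourable (p , e , pr , k≡p^e) 2<k 5g≤n L =
  cube-and-cancel k (numProper L) (suc (suc J)) (n * suc (suc J)) (totalDegree J) _ (3 * J)
    (colourings-bound G L _ 1≉0
      (≡.subst (RegularSubgroup _) (≡.sym k≡p^e) (digitSubgroup e (≡.subst (2 <_) k≡p^e 2<k)))
      (colourable L))
    (degree-bound n g J (totalDegree J) _ (numEdges G) (numComponents G) 5g≤n
      (totalDegree-eq J) treeEdges-count (euler-bound {g} euler))
  where
  open Forests G
  open Colourings G L
  open Faces G girth S
  open DigitPolynomials p pr
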